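{- For positive integers $k$ and $m_1,\dots,m_{k+1}$, with $M=m_1+\cdots+m_{k+1}$, \begin{align*} &\zeta\left(\overline{1},\{1\}_{m_1-1},2,\{1\}_{m_2-1},2,\ldots,\{1\}_{m_k-1},2,\{1\}_{m_{k+1}-1}\right)\\ &=\sum_{\sigma_1,\dots,\sigma_k\in\{\pm1\}}\frac{\mathrm{Li}_{\{1\}_{M+k}}\left(-1,\{1\}_{m_{k+1}-1},\sigma_1,\sigma_1,\{1\}_{m_k-1},\sigma_2,\sigma_2,\ldots,\{1\}_{m_2-1},\sigma_k,\sigma_k,\{1\}_{m_1-1}\right)}{(-1)^k\sigma_1\sigma_2\cdots\sigma_k}. \end{align*}
   Context: Alternating MZVs: for nonzero integers $s_j$ (overlined $\overline{s}$ means $-s$), $\zeta(s_1,\dots,s_k)=\sum_{n_1>\cdots>n_k\ge1}\prod_j\mathrm{sgn}(s_j)^{n_j}n_j^{ -|s_j|}$. Multiple polylogarithm: $\mathrm{Li}_{s_1,\dots,s_r}(z_1,\dots,z_r)=\sum_{n_1>\cdots>n_r\ge1}\frac{z_1^{n_1}\cdots z_r^{n_r}}{n_1^{s_1}\cdots n_r^{s_r}}$. $\{1\}_d$ denotes $d$ consecutive entries (arguments) equal to $1$, empty if $d=0$. -}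

module Defs where

open import Data.Nat using (ℕ; zero; suc; _∸_; _≤_)
open import Data.Integer using (+_)
open import Data.List using (List; []; _∷_; _++_; replicate; reverse; map; concatMap; foldr)
open import Data.Product using (_×_; _,_; ∃)
open import Data.Rational using (ℚ; 0ℚ; 1ℚ; _+_; _*_; _-_; -_; ∣_∣; _<_; _/_)

data Sgn : Set where
  ⊕ ⊖ : Sgn

sgnVal : Sgn → ℚ
sgnVal ⊕ = 1ℚ
sgnVal ⊖ = - 1ℚ

pow : ℚ → ℕ → ℚ
pow x zero = 1ℚ
pow x (suc n) = x * pow x n

-- 1 / n  (for n ≥ 1; value 0 at n = 0, never used)
inv : ℕ → ℚ
inv zero = 0ℚ
inv (suc k) = + 1 / suc k

sum1 : ℕ → (ℕ → ℚ) → ℚ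
sum1 zero f = 0ℚ
sum1 (suc m) f = sum1 m f + f (suc m)

-- an index entry (z , s) stands for the summand  z^n / n^s ,  z ∈ {±1}
-- (for alternating MZVs: s ↦ (⊕ , s),  s̄ ↦ (⊖ , s))
Entry : Set
Entry = Sgn × ℕ

term : Entry → ℕ → ℚ
term (z , s) n = pow (sgnVal z) n * pow (inv n) s

nested : ℕ → List Entry → ℚ
nested b [] = 1ℚ
nested b (e ∷ es) = sum1 (b ∸ 1) (λ n → term e n * nested n es)

partial : List Entry → ℕ → ℚ
partial es N = nested (suc N) es

-- ζ(s_1,...,s_k) truncated = partial of the entries (sgn s_j , |s_j|)
-- Li_{s_1..s_r}(z_1..z_r) truncated = partial of the entries (z_j , s_j)

ones : ℕ → List Entry
ones d = replicate d (⊕ , 1)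

zetaTail : List ℕ → List Entry
zetaTail [] = []
zetaTail (m ∷ ms) = ((⊕ , 2) ∷ ones (m ∸ 1)) ++ zetaTail ms

zetaIdx : List ℕ → List Entry
zetaIdx [] = []
zetaIdx (m ∷ ms) = ((⊖ , 1) ∷ ones (m ∸ 1)) ++ zetaTail ms

-- Li arguments (all weights 1), given rs = (m_{k+1}, m_k, ..., m_1) and σ = (σ_1,...,σ_k):
-- -1, {1}_{m_{k+1}-1}, σ_1, σ_1, {1}_{m_k-1}, ..., σ_k, σ_k, {1}_{m_1-1}
liTail : List Sgn → List ℕ → List Entry
liTail (σ ∷ σs) (r ∷ rs) = ((σ , 1) ∷ (σ , 1) ∷ ones (r ∸ 1)) ++ liTail σs rs
liTail _ _ = []

liIdx : List Sgn → List ℕ → List Entry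
liIdx σs [] = []
liIdx σs (r ∷ rs) = ((⊖ , 1) ∷ ones (r ∸ 1)) ++ liTail σs rs

allSigns : ℕ → List (List Sgn)
allSigns zero = [] ∷ []
allSigns (suc k) = concatMap (λ σs → (⊕ ∷ σs) ∷ (⊖ ∷ σs) ∷ []) (allSigns k)

prodSgn : List Sgn → ℚ
prodSgn = foldr (λ σ q → sgnVal σ * q) 1ℚ

sumList : List ℚ → ℚ
sumList = foldr _+_ 0ℚ

-- 1 / ((-1)^k σ_1⋯σ_k)  =  (-1)^k σ_1⋯σ_k   (it is ±1, hence its own inverse)
coeff : ℕ → List Sgn → ℚ
coeff k σs = pow (- 1ℚ) k * prodSgn σs

rhsPartial : ℕ → List ℕ → ℕ → ℚ
rhsPartial k ms N =
  sumList (map (λ σs → coeff k σs * partial (liIdx σs (reverse ms)) N) (allSigns k))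

Cauchy : (ℕ → ℚ) → Set
Cauchy a = ∀ (ε : ℚ) → 0ℚ < ε → ∃ λ N₀ → ∀ N N′ → N₀ ≤ N → N₀ ≤ N′ → ∣ a N - a N′ ∣ < ε

TendsToZero : (ℕ → ℚ) → Set
TendsToZero a = ∀ (ε : ℚ) → 0ℚ < ε → ∃ λ N₀ → ∀ N → N₀ ≤ N → ∣ a N ∣ < ε

{-# OPTIONS --safe #-}

-- The zeta value is the iterated integral from 0 to 1 of a word in A = −dt/(1+t) and B = dt/t; the substitution
-- t = (1−u)/(1+u) reverses the word, preserves A up to sign and turns B into a sum of two forms, one for each sign σᵢ.
-- With rational partial sums only, the integrals are replaced by power series in three coordinates. Euler's transformation
-- turns the t-series at t = 1 into a series in x = t/(1+t) = (1−u)/2 at x = ½. There the connected sum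
-- Σ f_w(m) g_v(n) C(m, n), with C(m, n) = 2⁻ᵐ m! n! / (m+n)!, does not change up to o(1) when the outermost letter of w
-- moves to v, because the differences of C in m telescope against its differences in n. Moving all letters
-- reaches the u-series of the reversed word at u = 1, which is the sum of multiple polylogarithms.

module Submission where

open import Defs
open import Data.Integer as ℤ using () renaming (+_ to pos)
import Data.Integer.Properties as ℤ
open import Data.List using (List; []; _∷_; _++_; length; map; concatMap; replicate; reverse; _ʳ++_)
open import Data.List.Properties using (length-reverse; map-cong; ++-ʳ++)
open import Data.List.Relation.Binary.Permutation.Propositional using (↭-sym)
open import Data.List.Relation.Binary.Permutation.Propositional.Properties using (All-resp-↭; ↭-reverse)
open import Data.List.Relation.Unary.All using (All; []; _∷_)
open import Data.Maybe using (Maybe; just; nothing)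
open import Data.Nat as ℕ using (ℕ; zero; suc; _∸_)
import Data.Nat.Properties as ℕ
open import Data.Product using (_×_; _,_; ∃; proj₁; proj₂)
open import Data.Rational using (ℚ; mkℚ; 0ℚ; 1ℚ; ½; _+_; _*_; _-_; -_; 1/_; ∣_∣; nonNegative; positive; toℚᵘ; fromℚᵘ)
open import Data.Rational.Properties
open import Data.Rational.Unnormalised as ℚᵘ using (mkℚᵘ; *≡*; *<*)
import Data.Rational.Unnormalised.Properties as ℚᵘ
open import Data.Sum using (_⊎_; inj₁; inj₂)
open import Relation.Binary.PropositionalEquality
open import Relation.Nullary using (yes; no)
open import Tactic.RingSolver using (solve-∀)
open import Tactic.RingSolver.Core.AlmostCommutativeRing using (AlmostCommutativeRing; fromCommutativeRing)

-- The obstacle is error control with rational numbers alone. Already the t-coefficient of a word of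
-- r letters `A` grows like (log n)^(r-1)/n, so multiples of 1/n do not bound it. All sizes are
-- therefore compared with `α`, about (πn)^(-1/2): a cruder scale, but averaging `α` at most doubles
-- it, so one constant per word suffices, and it still tends to zero. The alternating sums do not
-- converge absolutely, so no summations are interchanged in the limit. Each move of a letter is an
-- exact identity between finite sums, cut at n = N and m = 3N, with boundary terms at both cuts.
-- The factor 2⁻ᵐ of the connector makes those at m = 3N small. Those at n = N are partial sums of
-- u-coefficients multiplied by a factor 1/(N+1) that the connector supplies; they are averages, and
-- so again O(α).

module Estimates where

  open import Data.Rational using (_<_; _≤_)

  -- Order and arithmetic in ℚ

  ℚ-ring : AlmostCommutativeRing _ _
  ℚ-ring = fromCommutativeRing +-*-commutativeRing isZero
    where
    isZero : ∀ x → Maybe (0ℚ ≡ x)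
    isZero x with 0ℚ ≟ x
    ... | yes 0≡x = just 0≡x
    ... | no _ = nothing

  2ℚ : ℚ
  2ℚ = 1ℚ + 1ℚ

  *-mono-≤-nonNeg : ∀ {a b c d} → 0ℚ ≤ a → a ≤ b → 0ℚ ≤ c → c ≤ d → a * c ≤ b * d
  *-mono-≤-nonNeg {a} {b} {c} {d} 0≤a a≤b 0≤c c≤d = ≤-trans
    (*-monoʳ-≤-nonNeg c {{nonNegative 0≤c}} a≤b)
    (*-monoˡ-≤-nonNeg b {{nonNegative (≤-trans 0≤a a≤b)}} c≤d)

  *-monoʳ : ∀ {a b c} → 0ℚ ≤ a → b ≤ c → a * b ≤ a * c
  *-monoʳ {a} 0≤a = *-monoˡ-≤-nonNeg a {{nonNegative 0≤a}}

  *-nonNeg : ∀ {a b} → 0ℚ ≤ a → 0ℚ ≤ b → 0ℚ ≤ a * b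
  *-nonNeg {a} {b} 0≤a 0≤b = subst (_≤ a * b) (*-zeroʳ a) (*-monoʳ 0≤a 0≤b)

  +-nonNeg : ∀ {a b} → 0ℚ ≤ a → 0ℚ ≤ b → 0ℚ ≤ a + b
  +-nonNeg = +-mono-≤

  ≤-+-nonNeg : ∀ {a b} → 0ℚ ≤ b → a ≤ a + b
  ≤-+-nonNeg {a} {b} 0≤b = subst (_≤ a + b) (+-identityʳ a) (+-monoʳ-≤ a 0≤b)

  ≤-by : ∀ {x y} d → 0ℚ ≤ d → x + d ≡ y → x ≤ y
  ≤-by {x} d 0≤d eq = subst (x ≤_) eq (≤-+-nonNeg 0≤d)

  0≤1 : 0ℚ ≤ 1ℚ
  0≤1 = nonNegative⁻¹ 1ℚ

  0≤2 : 0ℚ ≤ 2ℚ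
  0≤2 = nonNegative⁻¹ 2ℚ

  0≤½ : 0ℚ ≤ ½
  0≤½ = nonNegative⁻¹ ½

  ∣+∣≤ : ∀ {a b c d} → ∣ a ∣ ≤ b → ∣ c ∣ ≤ d → ∣ a + c ∣ ≤ b + d
  ∣+∣≤ {a} {b} {c} a≤b c≤d = ≤-trans (∣p+q∣≤∣p∣+∣q∣ a c) (+-mono-≤ a≤b c≤d)

  ∣-∣≤ : ∀ {a b} → ∣ a ∣ ≤ b → ∣ - a ∣ ≤ b
  ∣-∣≤ {a} {b} = subst (_≤ b) (sym (∣-p∣≡∣p∣ a))

  ∣*∣≤ : ∀ {a b c d} → ∣ a ∣ ≤ b → ∣ c ∣ ≤ d → ∣ a * c ∣ ≤ b * d
  ∣*∣≤ {a} {b} {c} {d} a≤b c≤d = subst (_≤ b * d) (sym (∣p*q∣≡∣p∣*∣q∣ a c))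
    (*-mono-≤-nonNeg (0≤∣p∣ a) a≤b (0≤∣p∣ c) c≤d)

  ∣nonNeg∣≤ : ∀ {a b} → 0ℚ ≤ a → a ≤ b → ∣ a ∣ ≤ b
  ∣nonNeg∣≤ {b = b} 0≤a = subst (_≤ b) (sym (0≤p⇒∣p∣≡p 0≤a))

  ∣0∣≤ : ∀ {a b} → a ≡ 0ℚ → 0ℚ ≤ b → ∣ a ∣ ≤ b
  ∣0∣≤ refl 0≤b = 0≤b

  *-cancel-∣∣≤ : ∀ {a x y} → 0ℚ < a → ∣ a * x ∣ ≤ a * y → ∣ x ∣ ≤ y
  *-cancel-∣∣≤ {a} {x} {y} 0<a ax≤ay = *-cancelˡ-≤-pos a {{positive 0<a}}
    (subst (_≤ a * y) (trans (∣p*q∣≡∣p∣*∣q∣ a x) (cong (_* ∣ x ∣) (0≤p⇒∣p∣≡p (<⇒≤ 0<a)))) ax≤ay)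

  ι : ℕ → ℚ
  ι zero = 0ℚ
  ι (suc n) = ι n + 1ℚ

  ι-+ : ∀ m n → ι (m ℕ.+ n) ≡ ι m + ι n
  ι-+ zero n = sym (+-identityˡ (ι n))
  ι-+ (suc m) n = trans (cong (_+ 1ℚ) (ι-+ m n)) (shuffle (ι m) (ι n))
    where
    shuffle : ∀ a b → a + b + 1ℚ ≡ a + 1ℚ + b
    shuffle = solve-∀ ℚ-ring

  ι≡fraction : ∀ n → ι n ≡ fromℚᵘ (mkℚᵘ (pos n) 0)
  ι≡fraction zero = refl
  ι≡fraction (suc n) = trans (cong (_+ 1ℚ) (ι≡fraction n)) (toℚᵘ-injective (begin
    toℚᵘ (fromℚᵘ (mkℚᵘ (pos n) 0) + 1ℚ)       ≈⟨ toℚᵘ-homo-+ (fromℚᵘ (mkℚᵘ (pos n) 0)) 1ℚ ⟩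
    toℚᵘ (fromℚᵘ (mkℚᵘ (pos n) 0)) ℚᵘ.+ ℚᵘ.1ℚᵘ ≈⟨ ℚᵘ.+-congˡ ℚᵘ.1ℚᵘ (toℚᵘ-fromℚᵘ (mkℚᵘ (pos n) 0)) ⟩
    mkℚᵘ (pos n) 0 ℚᵘ.+ ℚᵘ.1ℚᵘ                 ≈⟨ *≡* (cong (ℤ._* pos 1) (trans (cong (ℤ._+ pos 1) (ℤ.*-identityʳ (pos n))) (cong pos (ℕ.+-comm n 1)))) ⟩
    mkℚᵘ (pos (suc n)) 0                         ≈⟨ ℚᵘ.≃-sym (toℚᵘ-fromℚᵘ (mkℚᵘ (pos (suc n)) 0)) ⟩
    toℚᵘ (fromℚᵘ (mkℚᵘ (pos (suc n)) 0))         ∎))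
    where
    open ℚᵘ.≃-Reasoning

  ι*inv : ∀ n → ι (suc n) * inv (suc n) ≡ 1ℚ
  ι*inv n = trans (cong (_* inv (suc n)) (ι≡fraction (suc n))) (toℚᵘ-injective (begin
    toℚᵘ (fromℚᵘ (mkℚᵘ (pos (suc n)) 0) * fromℚᵘ (mkℚᵘ (pos 1) n))           ≈⟨ toℚᵘ-homo-* (fromℚᵘ (mkℚᵘ (pos (suc n)) 0)) (fromℚᵘ (mkℚᵘ (pos 1) n)) ⟩
    toℚᵘ (fromℚᵘ (mkℚᵘ (pos (suc n)) 0)) ℚᵘ.* toℚᵘ (fromℚᵘ (mkℚᵘ (pos 1) n)) ≈⟨ ℚᵘ.*-cong (toℚᵘ-fromℚᵘ (mkℚᵘ (pos (suc n)) 0)) (toℚᵘ-fromℚᵘ (mkℚᵘ (pos 1) n)) ⟩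
    mkℚᵘ (pos (suc n)) 0 ℚᵘ.* mkℚᵘ (pos 1) n                                 ≈⟨ *≡* (cong pos (cong suc (cancel n))) ⟩
    ℚᵘ.1ℚᵘ ∎))
    where
    open ℚᵘ.≃-Reasoning
    cancel : ∀ n → n ℕ.* 1 ℕ.* 1 ≡ n ℕ.+ 0 ℕ.+ 0
    cancel n = trans (trans (ℕ.*-identityʳ (n ℕ.* 1)) (ℕ.*-identityʳ n)) (sym (trans (ℕ.+-identityʳ (n ℕ.+ 0)) (ℕ.+-identityʳ n)))

  ι-nonNeg : ∀ n → 0ℚ ≤ ι n
  ι-nonNeg zero = ≤-refl
  ι-nonNeg (suc n) = +-nonNeg (ι-nonNeg n) 0≤1

  ι-pos : ∀ n → 0ℚ < ι (suc n)
  ι-pos n = +-mono-≤-< (ι-nonNeg n) (positive⁻¹ 1ℚ)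

  ι-mono : ∀ {m n} → m ℕ.≤ n → ι m ≤ ι n
  ι-mono {n = n} ℕ.z≤n = ι-nonNeg n
  ι-mono (ℕ.s≤s m≤n) = +-monoˡ-≤ 1ℚ (ι-mono m≤n)

  inv-nonNeg : ∀ n → 0ℚ ≤ inv n
  inv-nonNeg zero = ≤-refl
  inv-nonNeg (suc n) = nonNegative⁻¹ (inv (suc n)) {{normalize-nonNeg 1 (suc n)}}

  inv*[ι*_]≡ : ∀ x n → inv (suc n) * (ι (suc n) * x) ≡ x
  inv*[ι*_]≡ x n = trans (shuffle (inv (suc n)) (ι (suc n)) x) (trans (cong (_* x) (ι*inv n)) (*-identityˡ x))
    where
    shuffle : ∀ a b x → a * (b * x) ≡ b * a * x
    shuffle = solve-∀ ℚ-ring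

  ι*[inv*_]≡ : ∀ x n → ι (suc n) * (inv (suc n) * x) ≡ x
  ι*[inv*_]≡ x n = trans (sym (*-assoc (ι (suc n)) (inv (suc n)) x)) (trans (cong (_* x) (ι*inv n)) (*-identityˡ x))

  ι*≤⇒≤inv* : ∀ {x y} n → ι (suc n) * x ≤ y → x ≤ inv (suc n) * y
  ι*≤⇒≤inv* {x} {y} n le = subst (_≤ inv (suc n) * y) (inv*[ι* x ]≡ n) (*-monoʳ (inv-nonNeg (suc n)) le)

  ≤ι*⇒inv*≤ : ∀ {x y} n → y ≤ ι (suc n) * x → inv (suc n) * y ≤ x
  ≤ι*⇒inv*≤ {x} {y} n le = subst (inv (suc n) * y ≤_) (inv*[ι* x ]≡ n) (*-monoʳ (inv-nonNeg (suc n)) le)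

  inv-antitone : ∀ {m n} → m ℕ.≤ n → inv (suc n) ≤ inv (suc m)
  inv-antitone {m} {n} m≤n = subst (_≤ inv (suc m)) (*-identityʳ (inv (suc n))) (≤ι*⇒inv*≤ n
    (subst (_≤ ι (suc n) * inv (suc m)) (ι*inv m)
      (*-mono-≤-nonNeg (ι-nonNeg (suc m)) (ι-mono (ℕ.s≤s m≤n)) (inv-nonNeg (suc m)) ≤-refl)))

  inv≤1 : ∀ n → inv n ≤ 1ℚ
  inv≤1 zero = 0≤1
  inv≤1 (suc n) = inv-antitone {0} {n} ℕ.z≤n

  sgn^ : ℕ → ℚ
  sgn^ = pow (- 1ℚ)

  sgn^-square : ∀ n → sgn^ n * sgn^ n ≡ 1ℚ
  sgn^-square zero = refl
  sgn^-square (suc n) = trans (shuffle (sgn^ n)) (sgn^-square n)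
    where
    shuffle : ∀ x → (- 1ℚ * x) * (- 1ℚ * x) ≡ x * x
    shuffle = solve-∀ ℚ-ring

  ∣sgn^∣ : ∀ n → ∣ sgn^ n ∣ ≤ 1ℚ
  ∣sgn^∣ zero = ≤-refl
  ∣sgn^∣ (suc n) = ∣*∣≤ {a = - 1ℚ} {b = 1ℚ} ≤-refl (∣sgn^∣ n)

  ∣sgn^*∣≤ : ∀ n {x y} → ∣ x ∣ ≤ y → ∣ sgn^ n * x ∣ ≤ y
  ∣sgn^*∣≤ n {x} {y} le = subst (∣ sgn^ n * x ∣ ≤_) (*-identityˡ y) (∣*∣≤ (∣sgn^∣ n) le)

  ½^ : ℕ → ℚ
  ½^ = pow ½

  ½^-nonNeg : ∀ n → 0ℚ ≤ ½^ n
  ½^-nonNeg zero = 0≤1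
  ½^-nonNeg (suc n) = *-nonNeg 0≤½ (½^-nonNeg n)

  ½^-suc≤ : ∀ n → ½^ (suc n) ≤ ½^ n
  ½^-suc≤ n = subst (½^ (suc n) ≤_) (*-identityˡ (½^ n))
    (*-mono-≤-nonNeg 0≤½ (≤-by ½ 0≤½ refl) (½^-nonNeg n) ≤-refl)

  ½^-antitone : ∀ {m n} → m ℕ.≤ n → ½^ n ≤ ½^ m
  ½^-antitone {m} m≤n = go (ℕ.≤⇒≤′ m≤n)
    where
    go : ∀ {n} → m ℕ.≤′ n → ½^ n ≤ ½^ m
    go (ℕ.≤′-reflexive refl) = ≤-refl
    go (ℕ.≤′-step {n} le) = ≤-trans (½^-suc≤ n) (go le)

  ½^-+ : ∀ m n → ½^ (m ℕ.+ n) ≡ ½^ m * ½^ n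
  ½^-+ zero n = sym (*-identityˡ (½^ n))
  ½^-+ (suc m) n = trans (cong (½ *_) (½^-+ m n)) (sym (*-assoc ½ (½^ m) (½^ n)))

  ι*½^≤1 : ∀ n → ι (suc n) * ½^ n ≤ 1ℚ
  ι*½^≤1 zero = ≤-refl
  ι*½^≤1 (suc n) = ≤-trans
    (≤-by (ι n * (½ * ½^ n)) (*-nonNeg (ι-nonNeg n) (½^-nonNeg (suc n))) (double (ι n) (½^ n)))
    (ι*½^≤1 n)
    where
    double : ∀ a b → (a + 1ℚ + 1ℚ) * (½ * b) + a * (½ * b) ≡ (a + 1ℚ) * b
    double = solve-∀ ℚ-ring

  -- Partial sums and the comparison scale

  cum : (ℕ → ℚ) → ℕ → ℚ
  cum x zero = 0ℚ
  cum x (suc n) = cum x n + x n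

  cum-cong : ∀ {x y} → (∀ j → x j ≡ y j) → ∀ n → cum x n ≡ cum y n
  cum-cong eq zero = refl
  cum-cong eq (suc n) = cong₂ _+_ (cum-cong eq n) (eq n)

  ∣cum∣≤cum : ∀ {x y} → (∀ j → ∣ x j ∣ ≤ y j) → ∀ n → ∣ cum x n ∣ ≤ cum y n
  ∣cum∣≤cum le zero = ≤-refl
  ∣cum∣≤cum le (suc n) = ∣+∣≤ (∣cum∣≤cum le n) (le n)

  cum-* : ∀ c x n → cum (λ j → c * x j) n ≡ c * cum x n
  cum-* c x zero = sym (*-zeroʳ c)
  cum-* c x (suc n) = trans (cong (_+ c * x n) (cum-* c x n)) (sym (*-distribˡ-+ c (cum x n) (x n)))

  ∣cum∣≤ι* : ∀ {x c} → (∀ j → ∣ x j ∣ ≤ c) → ∀ n → ∣ cum x n ∣ ≤ ι n * c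
  ∣cum∣≤ι* {x} {c} le zero = ≤-reflexive (sym (*-zeroˡ c))
  ∣cum∣≤ι* {x} {c} le (suc n) = subst (∣ cum x (suc n) ∣ ≤_) (factor (ι n) c) (∣+∣≤ (∣cum∣≤ι* le n) (le n))
    where
    factor : ∀ a c → a * c + c ≡ (a + 1ℚ) * c
    factor = solve-∀ ℚ-ring

  cum-suc≡sum1 : ∀ x → x 0 ≡ 0ℚ → ∀ n → cum x (suc n) ≡ sum1 n x
  cum-suc≡sum1 x x0 zero = trans (+-identityˡ (x 0)) x0
  cum-suc≡sum1 x x0 (suc n) = cong (_+ x (suc n)) (cum-suc≡sum1 x x0 n)

  sum1-cong : ∀ {x y} → (∀ j → x (suc j) ≡ y (suc j)) → ∀ n → sum1 n x ≡ sum1 n y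
  sum1-cong eq zero = refl
  sum1-cong eq (suc n) = cong₂ _+_ (sum1-cong eq n) (eq n)

  -- The scale α n = binomial(2n, n) / 4ⁿ; unlike 1/n it reproduces itself under averaging: cum α n = 2nα(n).

  α : ℕ → ℚ
  α zero = 1ℚ
  α (suc n) = α n * (1ℚ - ½ * inv (suc n))

  cum-α : ∀ n → cum α n ≡ 2ℚ * ι n * α n
  cum-α zero = refl
  cum-α (suc n) = begin
    cum α n + α n                                                   ≡⟨ cong (_+ α n) (cum-α n) ⟩
    2ℚ * ι n * α n + α n                                            ≡⟨ expand (ι n) (α n) ⟩
    α n * (2ℚ * ι (suc n) - 1ℚ)                                     ≡⟨ cong (λ y → α n * (2ℚ * ι (suc n) - y)) (sym (ι*inv n)) ⟩
    α n * (2ℚ * ι (suc n) - ι (suc n) * inv (suc n))                ≡⟨ factor (ι (suc n)) (α n) (inv (suc n)) ⟩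
    2ℚ * ι (suc n) * (α n * (1ℚ - ½ * inv (suc n)))                 ∎
    where
    open ≡-Reasoning
    expand : ∀ i a → (1ℚ + 1ℚ) * i * a + a ≡ a * ((1ℚ + 1ℚ) * (i + 1ℚ) - 1ℚ)
    expand = solve-∀ ℚ-ring
    factor : ∀ i a v → a * ((1ℚ + 1ℚ) * i - i * v) ≡ (1ℚ + 1ℚ) * i * (a * (1ℚ - ½ * v))
    factor = solve-∀ ℚ-ring

  ½inv-bounds : ∀ n → 0ℚ ≤ 1ℚ - ½ * inv (suc n) × 1ℚ - ½ * inv (suc n) ≤ 1ℚ
  ½inv-bounds n = 0≤1-½inv , ≤-by (½ * inv (suc n)) 0≤½inv (cancel (½ * inv (suc n)))
    where
    0≤½inv : 0ℚ ≤ ½ * inv (suc n)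
    0≤½inv = *-nonNeg 0≤½ (inv-nonNeg (suc n))
    cancel : ∀ x → 1ℚ - x + x ≡ 1ℚ
    cancel = solve-∀ ℚ-ring
    0≤1-½inv : 0ℚ ≤ 1ℚ - ½ * inv (suc n)
    0≤1-½inv = p≤q⇒0≤q-p (*-mono-≤-nonNeg {½} {1ℚ} {inv (suc n)} {1ℚ} 0≤½ (≤-by {½} {1ℚ} ½ 0≤½ refl) (inv-nonNeg (suc n)) (inv≤1 (suc n)))
      where
      p≤q⇒0≤q-p : ∀ {p q} → p ≤ q → 0ℚ ≤ q - p
      p≤q⇒0≤q-p {p} {q} p≤q = subst (_≤ q - p) (+-inverseʳ p) (+-monoˡ-≤ (- p) p≤q)

  α-nonNeg : ∀ n → 0ℚ ≤ α n
  α-nonNeg zero = 0≤1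
  α-nonNeg (suc n) = *-nonNeg (α-nonNeg n) (proj₁ (½inv-bounds n))

  α-suc≤ : ∀ n → α (suc n) ≤ α n
  α-suc≤ n = subst (α (suc n) ≤_) (*-identityʳ (α n)) (*-monoʳ (α-nonNeg n) (proj₂ (½inv-bounds n)))

  α≤1 : ∀ n → α n ≤ 1ℚ
  α≤1 zero = ≤-refl
  α≤1 (suc n) = ≤-trans (α-suc≤ n) (α≤1 n)

  inv*cum-α≤ : ∀ n → inv n * cum α n ≤ 2ℚ * α n
  inv*cum-α≤ zero = *-nonNeg 0≤2 0≤1
  inv*cum-α≤ (suc n) = ≤-reflexive (trans (cong (inv (suc n) *_) (trans (cum-α (suc n)) (shuffle 2ℚ (ι (suc n)) (α (suc n)))))
    (inv*[ι* 2ℚ * α (suc n) ]≡ n))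
    where
    shuffle : ∀ t i a → t * i * a ≡ i * (t * a)
    shuffle = solve-∀ ℚ-ring

  cum-α≤ι : ∀ n → cum α n ≤ ι n
  cum-α≤ι zero = ≤-refl
  cum-α≤ι (suc n) = +-mono-≤ (cum-α≤ι n) (α≤1 n)

  1≤cum-α : ∀ n → 1ℚ ≤ cum α (suc n)
  1≤cum-α zero = ≤-refl
  1≤cum-α (suc n) = ≤-trans (1≤cum-α n) (≤-+-nonNeg (α-nonNeg (suc n)))

  inv≤2α : ∀ n → inv (suc n) ≤ 2ℚ * α (suc n)
  inv≤2α n = ≤-trans (subst (_≤ inv (suc n) * cum α (suc n)) (*-identityʳ (inv (suc n))) (*-monoʳ (inv-nonNeg (suc n)) (1≤cum-α n)))
    (inv*cum-α≤ (suc n))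

  -- α(n)² (2n + 1) is decreasing, because (2n + 1)(2n + 3) ≤ (2n + 2)².
  α²-bound : ∀ n → α n * α n * (2ℚ * ι n + 1ℚ) ≤ 1ℚ
  α²-bound zero = ≤-refl
  α²-bound (suc n) = ≤-trans (≤-by (α n * α n * (½ * ½ * v * (1ℚ + 1ℚ - v))) nonneg decrement) (α²-bound n)
    where
    v = inv (suc n)
    nonneg : 0ℚ ≤ α n * α n * (½ * ½ * v * (1ℚ + 1ℚ - v))
    nonneg = *-nonNeg (*-nonNeg (α-nonNeg n) (α-nonNeg n)) (*-nonNeg (*-nonNeg (*-nonNeg 0≤½ 0≤½) (inv-nonNeg (suc n)))
      (subst (0ℚ ≤_) (shuffle v) (*-nonNeg 0≤2 (proj₁ (½inv-bounds n)))))
      where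
      shuffle : ∀ v → (1ℚ + 1ℚ) * (1ℚ - ½ * v) ≡ 1ℚ + 1ℚ - v
      shuffle = solve-∀ ℚ-ring
    decrement : α (suc n) * α (suc n) * (2ℚ * ι (suc n) + 1ℚ) + α n * α n * (½ * ½ * v * (1ℚ + 1ℚ - v)) ≡ α n * α n * (2ℚ * ι n + 1ℚ)
    decrement = trans (expand (ι n) (α n) v) (trans (cong (λ y → α n * α n * (2ℚ * ι (suc n) + 1ℚ - y * (1ℚ + 1ℚ) + v * (½ * (y - 1ℚ)))) (ι*inv n)) (collapse (ι n) (α n) v))
      where
      expand : ∀ i a v → (a * (1ℚ - ½ * v)) * (a * (1ℚ - ½ * v)) * ((1ℚ + 1ℚ) * (i + 1ℚ) + 1ℚ) + a * a * (½ * ½ * v * (1ℚ + 1ℚ - v))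
        ≡ a * a * ((1ℚ + 1ℚ) * (i + 1ℚ) + 1ℚ - (i + 1ℚ) * v * (1ℚ + 1ℚ) + v * (½ * ((i + 1ℚ) * v - 1ℚ)))
      expand = solve-∀ ℚ-ring
      collapse : ∀ i a v → a * a * ((1ℚ + 1ℚ) * (i + 1ℚ) + 1ℚ - 1ℚ * (1ℚ + 1ℚ) + v * (½ * (1ℚ - 1ℚ))) ≡ a * a * ((1ℚ + 1ℚ) * i + 1ℚ)
      collapse = solve-∀ ℚ-ring

  -- A stands for −dt/(1+t) and B for dt/t; a word is read from the outermost form inwards.
  data Letter : Set where
    A B : Letter

  -- The innermost letter may not be `B`: dt/t can be integrated from 0 only against a series
  -- without constant term.
  data Admissible : List Letter → Set where
    []   : Admissible []
    A∷_  : ∀ {w} → Admissible w → Admissible (A ∷ w)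
    B∷_  : ∀ {x w} → Admissible (x ∷ w) → Admissible (B ∷ x ∷ w)

  -- Coefficient sequences of iterated integrals

  δ : ℕ → ℚ
  δ zero = 1ℚ
  δ (suc n) = 0ℚ

  alt : (ℕ → ℚ) → ℕ → ℚ
  alt x n = sgn^ n * x n

  avg : (ℕ → ℚ) → ℕ → ℚ
  avg x n = inv n * cum x n

  signedCum : (ℕ → ℚ) → ℕ → ℚ
  signedCum q n = sgn^ n * cum q n

  -- This is the coefficient of uⁿ⁻¹ in 2/(1-u²) · Σⱼ (-1)ʲ q(j) uʲ. Equivalently, it is twice the
  -- sum of (-1)ʲ q(j) over those j < n for which n - j is odd.
  parityCum : (ℕ → ℚ) → ℕ → ℚ
  parityCum q n = cum (alt q) n - sgn^ n * cum q n

  parityAvg : (ℕ → ℚ) → ℕ → ℚ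
  parityAvg q n = inv n * (sgn^ n * cum (alt q) n - cum q n)

  -- In x = t/(1+t) the form `A` is -dx/(1-x) and `B` is dx/(x(1-x)). Dividing by 1-x takes partial
  -- sums; the extra 1/x in `B` shifts the index, which makes the sum in `avgIncl` inclusive.
  negAvg : (ℕ → ℚ) → ℕ → ℚ
  negAvg f m = - avg f m

  avgIncl : (ℕ → ℚ) → ℕ → ℚ
  avgIncl f m = inv m * cum f (suc m)

  -- The iterated integral of w from t = 0 is Σₙ (−1)ⁿ tCoeff w n tⁿ.
  tCoeff : List Letter → ℕ → ℚ
  tCoeff []      = δ
  tCoeff (A ∷ w) = avg (tCoeff w)
  tCoeff (B ∷ w) n = inv n * tCoeff w n

  -- The same integral is Σₘ xCoeff w m xᵐ in the coordinate x = t/(1+t).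
  xCoeff : List Letter → ℕ → ℚ
  xCoeff []      = δ
  xCoeff (A ∷ w) = negAvg (xCoeff w)
  xCoeff (B ∷ w) = avgIncl (xCoeff w)

  -- Σₙ (−1)ⁿ uCoeff v n uⁿ is the iterated integral from u = 0 after the substitution t = (1−u)/(1+u),
  -- under which A becomes du/(1+u) and B becomes −(du/(1−u) + du/(1+u)); reversing the path changes both signs.
  uCoeff : List Letter → ℕ → ℚ
  uCoeff []      = δ
  uCoeff (A ∷ v) = avg (uCoeff v)
  uCoeff (B ∷ v) = parityAvg (uCoeff v)

  -- Size of the coefficients

  record αBounded (x : ℕ → ℚ) : Set where
    constructor mkαBounded
    field
      bound : ℚ
      holds : ∀ n → ∣ x n ∣ ≤ bound * α n

    bound-nonNeg : 0ℚ ≤ bound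
    bound-nonNeg = subst (0ℚ ≤_) (*-identityʳ bound) (≤-trans (0≤∣p∣ (x 0)) (holds 0))

    bounded : ∀ n → ∣ x n ∣ ≤ bound
    bounded n = ≤-trans (holds n) (subst (bound * α n ≤_) (*-identityʳ bound) (*-monoʳ bound-nonNeg (α≤1 n)))

    cum-bounded : ∀ n → ∣ cum x n ∣ ≤ bound * cum α n
    cum-bounded n = subst (∣ cum x n ∣ ≤_) (cum-* bound α n) (∣cum∣≤cum holds n)

    cum-bounded-ι : ∀ n → ∣ cum x n ∣ ≤ bound * ι n
    cum-bounded-ι n = ≤-trans (cum-bounded n) (*-monoʳ bound-nonNeg (cum-α≤ι n))

  open αBounded public

  -- Each letter acts, up to sign, as 1/n times some y built from the previous coefficients. Only
  -- the comparison quantity s differs: `α n` itself, or one of its partial sums.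
  inv*-bound : ∀ {c d s y} n → 0ℚ ≤ c → ∣ y ∣ ≤ c * s → inv n * s ≤ d * α n → ∣ inv n * y ∣ ≤ c * d * α n
  inv*-bound {c} {d} {s} {y} n 0≤c y≤ s≤ = ≤-trans
    (∣*∣≤ {inv n} {inv n} {y} {c * s} (∣nonNeg∣≤ (inv-nonNeg n) ≤-refl) y≤)
    (subst (_≤ c * d * α n) (shuffle c (inv n) s) (subst (c * (inv n * s) ≤_) (sym (*-assoc c d (α n))) (*-monoʳ 0≤c s≤)))
    where
    shuffle : ∀ c v s → c * (v * s) ≡ v * (c * s)
    shuffle = solve-∀ ℚ-ring

  avg-αBounded : ∀ {x} → αBounded x → αBounded (avg x)
  avg-αBounded b = mkαBounded (bound b * 2ℚ) λ n → inv*-bound n (bound-nonNeg b) (cum-bounded b n) (inv*cum-α≤ n)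

  alt-αBounded : ∀ {x} → αBounded x → αBounded (alt x)
  alt-αBounded (mkαBounded c h) = mkαBounded c λ n → ∣sgn^*∣≤ n (h n)

  neg-αBounded : ∀ {x} → αBounded x → αBounded (λ n → - x n)
  neg-αBounded (mkαBounded c h) = mkαBounded c λ n → ∣-∣≤ (h n)

  inv*α≤ : ∀ n → inv n * α n ≤ 1ℚ * α n
  inv*α≤ n = *-mono-≤-nonNeg (inv-nonNeg n) (inv≤1 n) (α-nonNeg n) ≤-refl

  δ-αBounded : αBounded δ
  δ-αBounded = mkαBounded 1ℚ λ where
    zero    → ≤-refl
    (suc n) → *-nonNeg 0≤1 (α-nonNeg (suc n))

  tCoeff-αBounded : ∀ w → αBounded (tCoeff w)
  tCoeff-αBounded []      = δ-αBounded
  tCoeff-αBounded (A ∷ w) = avg-αBounded (tCoeff-αBounded w)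
  tCoeff-αBounded (B ∷ w) = mkαBounded (bound b * 1ℚ) λ n → inv*-bound n (bound-nonNeg b) (holds b n) (inv*α≤ n)
    where b = tCoeff-αBounded w

  xCoeff-αBounded : ∀ w → αBounded (xCoeff w)
  xCoeff-αBounded []      = δ-αBounded
  xCoeff-αBounded (A ∷ w) = neg-αBounded (avg-αBounded (xCoeff-αBounded w))
  xCoeff-αBounded (B ∷ w) = mkαBounded (bound b * (2ℚ + 1ℚ)) λ n → inv*-bound n (bound-nonNeg b) (cum-bounded b (suc n)) (average n)
    where
    b = xCoeff-αBounded w
    average : ∀ n → inv n * cum α (suc n) ≤ (2ℚ + 1ℚ) * α n
    average n = subst₂ _≤_ (sym (*-distribˡ-+ (inv n) (cum α n) (α n))) (sym (*-distribʳ-+ (α n) 2ℚ 1ℚ))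
      (+-mono-≤ (inv*cum-α≤ n) (inv*α≤ n))

  module _ {x : ℕ → ℚ} (b : αBounded x) where

    signedCum-bound : ∀ n → ∣ signedCum x n ∣ ≤ bound b * cum α n
    signedCum-bound n = ∣sgn^*∣≤ n (cum-bounded b n)

    parityCum-bound : ∀ n → ∣ parityCum x n ∣ ≤ (bound b * 2ℚ) * cum α n
    parityCum-bound n = subst (∣ parityCum x n ∣ ≤_) (double (bound b) (cum α n))
      (∣+∣≤ (cum-bounded (alt-αBounded b) n) (∣-∣≤ (signedCum-bound n)))
      where
      double : ∀ c s → c * s + c * s ≡ (c * (1ℚ + 1ℚ)) * s
      double = solve-∀ ℚ-ring

  uCoeff-αBounded : ∀ v → αBounded (uCoeff v)
  uCoeff-αBounded []      = δ-αBounded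
  uCoeff-αBounded (A ∷ v) = avg-αBounded (uCoeff-αBounded v)
  uCoeff-αBounded (B ∷ v) = mkαBounded (bound b * 2ℚ * 2ℚ) λ n → inv*-bound n (*-nonNeg (bound-nonNeg b) 0≤2) (numerator n) (inv*cum-α≤ n)
    where
    b = uCoeff-αBounded v
    numerator : ∀ n → ∣ sgn^ n * cum (alt (uCoeff v)) n - cum (uCoeff v) n ∣ ≤ (bound b * 2ℚ) * cum α n
    numerator n = subst (λ y → ∣ y ∣ ≤ (bound b * 2ℚ) * cum α n)
      (trans (expand (sgn^ n) (cum (alt (uCoeff v)) n) (cum (uCoeff v) n))
        (trans (cong (λ y → sgn^ n * cum (alt (uCoeff v)) n - y * cum (uCoeff v) n) (sgn^-square n))
          (cong (λ y → sgn^ n * cum (alt (uCoeff v)) n - y) (*-identityˡ (cum (uCoeff v) n)))))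
      (∣sgn^*∣≤ n (parityCum-bound b n))
      where
      expand : ∀ e g u → e * (g - e * u) ≡ e * g - e * e * u
      expand = solve-∀ ℚ-ring

  xCoeff-zero : ∀ x w → xCoeff (x ∷ w) 0 ≡ 0ℚ
  xCoeff-zero A w = refl
  xCoeff-zero B w = *-zeroˡ (cum (xCoeff w) 1)

  tCoeff-zero : ∀ x w → tCoeff (x ∷ w) 0 ≡ 0ℚ
  tCoeff-zero A w = *-zeroˡ (cum (tCoeff w) 0)
  tCoeff-zero B w = *-zeroˡ (tCoeff w 0)

  -- The connector C m n = 2⁻ᵐ m! n! / (m+n)!, which is the integral of uⁿ d(xᵐ) over 0 ≤ u ≤ 1, x = (1−u)/2, when m > 0.

  C : ℕ → ℕ → ℚ
  C zero n = 1ℚ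
  C (suc m) n = C m n * (½ * ι (suc m) * inv (suc (m ℕ.+ n)))

  C-sucʳ : ∀ m n → C m (suc n) ≡ C m n * (ι (suc n) * inv (suc (m ℕ.+ n)))
  C-sucʳ zero n = sym (trans (*-identityˡ (ι (suc n) * inv (suc n))) (ι*inv n))
  C-sucʳ (suc m) n = begin
    C m (suc n) * (½ * ι (suc m) * inv (suc (m ℕ.+ suc n)))
      ≡⟨ cong₂ (λ x k → x * (½ * ι (suc m) * inv (suc k))) (C-sucʳ m n) (ℕ.+-suc m n) ⟩
    C m n * (ι (suc n) * inv (suc (m ℕ.+ n))) * (½ * ι (suc m) * inv (suc (suc (m ℕ.+ n))))
      ≡⟨ shuffle (C m n) (ι (suc n)) (inv (suc (m ℕ.+ n))) (½ * ι (suc m)) (inv (suc (suc (m ℕ.+ n)))) ⟩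
    C m n * (½ * ι (suc m) * inv (suc (m ℕ.+ n))) * (ι (suc n) * inv (suc (suc (m ℕ.+ n)))) ∎
    where
    open ≡-Reasoning
    shuffle : ∀ c i v j w → c * (i * v) * (j * w) ≡ c * (j * v) * (i * w)
    shuffle = solve-∀ ℚ-ring

  C-nonNeg : ∀ m n → 0ℚ ≤ C m n
  C-nonNeg zero n = 0≤1
  C-nonNeg (suc m) n = *-nonNeg (C-nonNeg m n) (*-nonNeg (*-nonNeg 0≤½ (ι-nonNeg (suc m))) (inv-nonNeg (suc (m ℕ.+ n))))

  ι*inv≤1 : ∀ {m n} → m ℕ.≤ n → ι (suc m) * inv (suc n) ≤ 1ℚ
  ι*inv≤1 {m} {n} m≤n = subst (ι (suc m) * inv (suc n) ≤_) (ι*inv n)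
    (*-mono-≤-nonNeg (ι-nonNeg (suc m)) (ι-mono (ℕ.s≤s m≤n)) (inv-nonNeg (suc n)) ≤-refl)

  C-sucˡ≤ : ∀ m n {y} → C m n ≤ y → 0ℚ ≤ y → C (suc m) n ≤ ½ * y
  C-sucˡ≤ m n {y} C≤y 0≤y = subst₂ _≤_ (shuffle (C m n) (ι (suc m)) (inv (suc (m ℕ.+ n)))) (*-identityʳ (½ * y))
    (*-mono-≤-nonNeg (*-nonNeg 0≤½ (C-nonNeg m n)) (*-monoʳ 0≤½ C≤y)
      (*-nonNeg (ι-nonNeg (suc m)) (inv-nonNeg (suc (m ℕ.+ n)))) (ι*inv≤1 (ℕ.m≤m+n m n)))
    where
    shuffle : ∀ c i v → ½ * c * (i * v) ≡ c * (½ * i * v)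
    shuffle = solve-∀ ℚ-ring

  C-sucʳ≤ : ∀ m n → C m (suc n) ≤ C m n
  C-sucʳ≤ m n = subst₂ _≤_ (sym (C-sucʳ m n)) (*-identityʳ (C m n)) (*-monoʳ (C-nonNeg m n) (ι*inv≤1 (ℕ.m≤n+m n m)))

  C≤½^ : ∀ m n → C m n ≤ ½^ m
  C≤½^ zero n = ≤-refl
  C≤½^ (suc m) n = C-sucˡ≤ m n (C≤½^ m n) (½^-nonNeg m)

  -- From m = 1 on the connector gains 1/(n+1) over its geometric decay, because `C 1 n` is ½/(n+1)
  -- and later factors are at most ½. This gain controls the cut at n = N.
  C≤½^*inv : ∀ m n → C (suc m) n ≤ ½^ (suc m) * inv (suc n)
  C≤½^*inv zero n = ≤-reflexive (trans (*-identityˡ (½ * ι 1 * inv (suc n))) refl)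
  C≤½^*inv (suc m) n = subst (C (suc (suc m)) n ≤_) (sym (*-assoc ½ (½^ (suc m)) (inv (suc n))))
    (C-sucˡ≤ (suc m) n (C≤½^*inv m n) (*-nonNeg (½^-nonNeg (suc m)) (inv-nonNeg (suc n))))

  C-zeroʳ : ∀ m → C m 0 ≡ ½^ m
  C-zeroʳ zero = refl
  C-zeroʳ (suc m) = begin
    C m 0 * (½ * ι (suc m) * inv (suc (m ℕ.+ 0))) ≡⟨ cong₂ (λ x k → x * (½ * ι (suc m) * inv (suc k))) (C-zeroʳ m) (ℕ.+-identityʳ m) ⟩
    ½^ m * (½ * ι (suc m) * inv (suc m))          ≡⟨ shuffle (½^ m) (ι (suc m)) (inv (suc m)) ⟩
    ½ * ½^ m * (ι (suc m) * inv (suc m))          ≡⟨ cong (½ * ½^ m *_) (ι*inv m) ⟩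
    ½ * ½^ m * 1ℚ                                 ≡⟨ *-identityʳ (½ * ½^ m) ⟩
    ½ * ½^ m                                      ∎
    where
    open ≡-Reasoning
    shuffle : ∀ c i v → c * (½ * i * v) ≡ ½ * c * (i * v)
    shuffle = solve-∀ ℚ-ring

  ι-sum*inv : ∀ m n → (ι m + ι n + 1ℚ) * inv (suc (m ℕ.+ n)) ≡ 1ℚ
  ι-sum*inv m n = trans (cong (λ x → (x + 1ℚ) * inv (suc (m ℕ.+ n))) (sym (ι-+ m n))) (ι*inv (m ℕ.+ n))

  -- The identity 1 - x = (1+u)/2 under the integral sign: by parts, C m (n+1) is the integral of xᵐ
  -- d(uⁿ⁺¹), so the left side is that of (m+1)(n+1) xᵐ (1-x) uⁿ du, where (m+1) xᵐ du/2 = -d(xᵐ⁺¹).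
  C-difference-A : ∀ m n → ι (suc m) * (C m (suc n) - C (suc m) (suc n)) ≡ ι (suc n) * (C (suc m) n + C (suc m) (suc n))
  C-difference-A m n = begin
    ι (suc m) * (C m (suc n) - C (suc m) (suc n))
      ≡⟨ cong₂ (λ x y → ι (suc m) * (x - y)) (C-sucʳ m n) (C-sucʳ (suc m) n) ⟩
    ι (suc m) * (L * (ι (suc n) * v) - C (suc m) n * (ι (suc n) * v′))
      ≡⟨ split L (ι m) (ι n) v v′ ⟩
    ι (suc n) * (C (suc m) n + C (suc m) n * (ι (suc n) * v′)) + defect (1ℚ - (ι (suc m) + ι n + 1ℚ) * v′)
      ≡⟨ cong₂ (λ x y → ι (suc n) * (C (suc m) n + x) + defect (1ℚ - y)) (sym (C-sucʳ (suc m) n)) (ι-sum*inv (suc m) n) ⟩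
    ι (suc n) * (C (suc m) n + C (suc m) (suc n)) + defect (1ℚ - 1ℚ)
      ≡⟨ vanish (ι (suc n) * (C (suc m) n + C (suc m) (suc n))) (½ * L * ι (suc m) * ι (suc n) * v) ⟩
    ι (suc n) * (C (suc m) n + C (suc m) (suc n)) ∎
    where
    open ≡-Reasoning
    L = C m n
    v = inv (suc (m ℕ.+ n))
    v′ = inv (suc (suc (m ℕ.+ n)))
    -- The ring solver sees v and v′ as free variables. Both sides differ by a multiple of 1 -
    -- (m+n+2)v′, which is collected here and vanishes because v′ = 1/(m+n+2).
    defect : ℚ → ℚ
    defect x = ½ * L * ι (suc m) * ι (suc n) * v * x
    split : ∀ L m n v v′ → (m + 1ℚ) * (L * ((n + 1ℚ) * v) - L * (½ * (m + 1ℚ) * v) * ((n + 1ℚ) * v′))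
      ≡ (n + 1ℚ) * (L * (½ * (m + 1ℚ) * v) + L * (½ * (m + 1ℚ) * v) * ((n + 1ℚ) * v′))
        + ½ * L * (m + 1ℚ) * (n + 1ℚ) * v * (1ℚ - (m + 1ℚ + n + 1ℚ) * v′)
    split = solve-∀ ℚ-ring
    vanish : ∀ x d → x + d * (1ℚ - 1ℚ) ≡ x
    vanish = solve-∀ ℚ-ring

  -- Here the identity under the integral sign is x(1-x) = (1-u²)/4. The factor 1-u² causes the step
  -- of length two in n, which matches the parity condition in `parityCum`.
  C-difference-B : ∀ m n → 2ℚ * ι m * (C m (suc n) - C (suc m) (suc n)) ≡ ι (suc n) * (C m n - C m (suc (suc n)))
  C-difference-B m n = begin
    2ℚ * ι m * (C m (suc n) - C (suc m) (suc n))
      ≡⟨ cong₂ (λ x y → 2ℚ * ι m * (x - y)) C₁ C₁₁ ⟩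
    2ℚ * ι m * (L * (ι (suc n) * v) - L * (ι (suc n) * v) * (½ * ι (suc m) * v′))
      ≡⟨ split L (ι m) (ι n) v v′ ⟩
    ι (suc n) * (L * ((ι m + ι n + 1ℚ) * v) - L * (ι (suc n) * v) * (ι (suc (suc n)) * v′))
      + defect (1ℚ - (ι (suc m) + ι n + 1ℚ) * v′)
      ≡⟨ cong₂ (λ x y → ι (suc n) * (L * x - L * (ι (suc n) * v) * (ι (suc (suc n)) * v′)) + defect (1ℚ - y)) (ι-sum*inv m n) (ι-sum*inv (suc m) n) ⟩
    ι (suc n) * (L * 1ℚ - L * (ι (suc n) * v) * (ι (suc (suc n)) * v′)) + defect (1ℚ - 1ℚ)
      ≡⟨ vanish (ι (suc n)) L (L * (ι (suc n) * v) * (ι (suc (suc n)) * v′)) (L * ι (suc n) * v * (2ℚ * ι m - (ι m + ι n + 1ℚ))) ⟩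
    ι (suc n) * (L - L * (ι (suc n) * v) * (ι (suc (suc n)) * v′))
      ≡⟨ cong (λ x → ι (suc n) * (L - x)) (sym C₂) ⟩
    ι (suc n) * (C m n - C m (suc (suc n))) ∎
    where
    open ≡-Reasoning
    L = C m n
    v = inv (suc (m ℕ.+ n))
    v′ = inv (suc (suc (m ℕ.+ n)))
    defect : ℚ → ℚ
    defect x = L * ι (suc n) * v * (2ℚ * ι m - (ι m + ι n + 1ℚ)) * x
    C₁ : C m (suc n) ≡ L * (ι (suc n) * v)
    C₁ = C-sucʳ m n
    C₁₁ : C (suc m) (suc n) ≡ L * (ι (suc n) * v) * (½ * ι (suc m) * v′)
    C₁₁ = cong₂ (λ x k → x * (½ * ι (suc m) * inv (suc k))) C₁ (ℕ.+-suc m n)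
    C₂ : C m (suc (suc n)) ≡ L * (ι (suc n) * v) * (ι (suc (suc n)) * v′)
    C₂ = trans (C-sucʳ m (suc n)) (cong₂ (λ x k → x * (ι (suc (suc n)) * inv (suc k))) C₁ (ℕ.+-suc m n))
    split : ∀ L m n v v′ → (1ℚ + 1ℚ) * m * (L * ((n + 1ℚ) * v) - L * ((n + 1ℚ) * v) * (½ * (m + 1ℚ) * v′))
      ≡ (n + 1ℚ) * (L * ((m + n + 1ℚ) * v) - L * ((n + 1ℚ) * v) * ((n + 1ℚ + 1ℚ) * v′))
        + L * (n + 1ℚ) * v * ((1ℚ + 1ℚ) * m - (m + n + 1ℚ)) * (1ℚ - (m + 1ℚ + n + 1ℚ) * v′)
    split = solve-∀ ℚ-ring
    vanish : ∀ n L x d → n * (L * 1ℚ - x) + d * (1ℚ - 1ℚ) ≡ n * (L - x)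
    vanish = solve-∀ ℚ-ring

  -- Moving one form across the connector

  dot : (ℕ → ℚ) → (ℕ → ℚ) → ℕ → ℚ
  dot x y K = cum (λ m → x m * y m) (suc K)

  -- For m > 0 this is the integral of Σₙ x(n) uⁿ d((½(1-u))ᵐ) over 0 ≤ u ≤ 1, taken without
  -- orientation sign and with the series cut at n = N.
  moment : ℕ → (ℕ → ℚ) → ℕ → ℚ
  moment N x m = dot x (C m) N

  alt-parityAvg : ∀ q n → ι (suc n) * alt (parityAvg q) (suc n) ≡ parityCum q (suc n)
  alt-parityAvg q n = begin
    i * (e * (inv (suc n) * (e * X - Y)))  ≡⟨ shuffle i e (inv (suc n)) X Y ⟩
    i * inv (suc n) * (e * e * X - e * Y)  ≡⟨ cong₂ (λ a b → a * (b * X - e * Y)) (ι*inv n) (sgn^-square (suc n)) ⟩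
    1ℚ * (1ℚ * X - e * Y)                  ≡⟨ units X (e * Y) ⟩
    X - e * Y                              ∎
    where
    open ≡-Reasoning
    i = ι (suc n)
    e = sgn^ (suc n)
    X = cum (alt q) (suc n)
    Y = cum q (suc n)
    shuffle : ∀ i e v X Y → i * (e * (v * (e * X - Y))) ≡ i * v * (e * e * X - e * Y)
    shuffle = solve-∀ ℚ-ring
    units : ∀ X Y → 1ℚ * (1ℚ * X - Y) ≡ X - Y
    units = solve-∀ ℚ-ring

  -- Summation by parts in n. By `C-difference-A` the new summand is a multiple of C(m+1, N) +
  -- C(m+1, N+1): the first part cancels the old boundary term, and the second combines with the new
  -- value of q into the next one.
  moment-A : ∀ q m N → ι (suc m) * (moment N (alt (avg q)) m - moment N (alt (avg q)) (suc m))
    ≡ - moment N (alt q) (suc m) - signedCum q (suc N) * C (suc m) N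
  moment-A q m zero = base (ι (suc m)) (C m 0) (C (suc m) 0) (q 0)
    where
    base : ∀ i c c′ y → i * ((0ℚ + 1ℚ * (0ℚ * 0ℚ) * c) - (0ℚ + 1ℚ * (0ℚ * 0ℚ) * c′)) ≡ - (0ℚ + 1ℚ * y * c′) - - 1ℚ * 1ℚ * (0ℚ + y) * c′
    base = solve-∀ ℚ-ring
  moment-A q m (suc N) = begin
    i * (M + e * (v * Q) * c - (M′ + e * (v * Q) * c′))
      ≡⟨ split i M M′ (e * (v * Q)) c c′ ⟩
    i * (M - M′) + e * (v * Q) * (i * (c - c′))
      ≡⟨ cong₂ (λ x y → x + e * (v * Q) * y) (moment-A q m N) (C-difference-A m N) ⟩
    - G - e * Q * c₀ + e * (v * Q) * (ι (suc N) * (c₀ + c′))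
      ≡⟨ regroup G e Q c₀ c′ v (ι (suc N)) ⟩
    - G - e * Q * c₀ + e * (ι (suc N) * v) * Q * (c₀ + c′)
      ≡⟨ cong (λ x → - G - e * Q * c₀ + e * x * Q * (c₀ + c′)) (ι*inv N) ⟩
    - G - e * Q * c₀ + e * 1ℚ * Q * (c₀ + c′)
      ≡⟨ collect G e Q c₀ c′ (q (suc N)) ⟩
    - (G + e * q (suc N) * c′) - - 1ℚ * e * (Q + q (suc N)) * c′ ∎
    where
    open ≡-Reasoning
    i = ι (suc m)
    M = moment N (alt (avg q)) m
    M′ = moment N (alt (avg q)) (suc m)
    G = moment N (alt q) (suc m)
    e = sgn^ (suc N)
    v = inv (suc N)
    Q = cum q (suc N)
    c = C m (suc N)
    c′ = C (suc m) (suc N)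
    c₀ = C (suc m) N
    split : ∀ i M M′ x c c′ → i * (M + x * c - (M′ + x * c′)) ≡ i * (M - M′) + x * (i * (c - c′))
    split = solve-∀ ℚ-ring
    regroup : ∀ G e Q c₀ c′ v n → - G - e * Q * c₀ + e * (v * Q) * (n * (c₀ + c′)) ≡ - G - e * Q * c₀ + e * (n * v) * Q * (c₀ + c′)
    regroup = solve-∀ ℚ-ring
    collect : ∀ G e Q c₀ c′ y → - G - e * Q * c₀ + e * 1ℚ * Q * (c₀ + c′) ≡ - (G + e * y * c′) - - 1ℚ * e * (Q + y) * c′
    collect = solve-∀ ℚ-ring

  -- The same telescoping, now with steps of length two in n; hence two neighbouring boundary terms
  -- survive.
  moment-B : ∀ q m N → 2ℚ * ι m * (moment N (alt (parityAvg q)) m - moment N (alt (parityAvg q)) (suc m))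
    ≡ 2ℚ * moment N (alt q) m - parityCum q (suc N) * C m N - parityCum q N * C m (suc N)
  moment-B q m zero = base (ι m) (C m 0) (C (suc m) 0) (C m 1) (q 0)
    where
    base : ∀ i c c′ c₁ y → (1ℚ + 1ℚ) * i * ((0ℚ + 1ℚ * (0ℚ * (1ℚ * 0ℚ - 0ℚ)) * c) - (0ℚ + 1ℚ * (0ℚ * (1ℚ * 0ℚ - 0ℚ)) * c′))
      ≡ (1ℚ + 1ℚ) * (0ℚ + 1ℚ * y * c) - (0ℚ + 1ℚ * y - - 1ℚ * 1ℚ * (0ℚ + y)) * c - (0ℚ - 1ℚ * 0ℚ) * c₁
    base = solve-∀ ℚ-ring
  moment-B q m (suc N) = begin
    2ℚ * i * (M + x * c₁ - (M′ + x * c′))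
      ≡⟨ split i M M′ x c₁ c′ ⟩
    2ℚ * i * (M - M′) + x * (2ℚ * i * (c₁ - c′))
      ≡⟨ cong₂ (λ a b → a + x * b) (moment-B q m N) (C-difference-B m N) ⟩
    2ℚ * G - parityCum q (suc N) * c₀ - parityCum q N * c₁ + x * (ι (suc N) * (c₀ - c₂))
      ≡⟨ cong (λ y → 2ℚ * G - parityCum q (suc N) * c₀ - parityCum q N * c₁ + y) (trans (shuffle x (ι (suc N)) (c₀ - c₂)) (cong (_* (c₀ - c₂)) (alt-parityAvg q N))) ⟩
    2ℚ * G - parityCum q (suc N) * c₀ - parityCum q N * c₁ + parityCum q (suc N) * (c₀ - c₂)
      ≡⟨ collect G X Y e (q N) (q (suc N)) c₀ c₁ c₂ ⟩
    2ℚ * (G + - 1ℚ * e * q (suc N) * c₁) - parityCum q (suc (suc N)) * c₁ - parityCum q (suc N) * c₂ ∎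
    where
    open ≡-Reasoning
    i = ι m
    M = moment N (alt (parityAvg q)) m
    M′ = moment N (alt (parityAvg q)) (suc m)
    G = moment N (alt q) m
    e = sgn^ N
    x = alt (parityAvg q) (suc N)
    X = cum (alt q) N
    Y = cum q N
    c₀ = C m N
    c₁ = C m (suc N)
    c₂ = C m (suc (suc N))
    c′ = C (suc m) (suc N)
    split : ∀ i M M′ x c c′ → (1ℚ + 1ℚ) * i * (M + x * c - (M′ + x * c′)) ≡ (1ℚ + 1ℚ) * i * (M - M′) + x * ((1ℚ + 1ℚ) * i * (c - c′))
    split = solve-∀ ℚ-ring
    shuffle : ∀ x n d → x * (n * d) ≡ n * x * d
    shuffle = solve-∀ ℚ-ring
    collect : ∀ G X Y e y z c₀ c₁ c₂ →
      (1ℚ + 1ℚ) * G - (X + e * y - - 1ℚ * e * (Y + y)) * c₀ - (X - e * Y) * c₁ + (X + e * y - - 1ℚ * e * (Y + y)) * (c₀ - c₂)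
      ≡ (1ℚ + 1ℚ) * (G + - 1ℚ * e * z * c₁)
        - (X + e * y + - 1ℚ * e * z - - 1ℚ * (- 1ℚ * e) * (Y + y + z)) * c₁ - (X + e * y - - 1ℚ * e * (Y + y)) * c₂
    collect = solve-∀ ℚ-ring

  -- Summation by parts in m. The factor m from `moment-A` cancels the 1/m in `negAvg`, leaving
  -- partial sums of f against differences of moments. The two error terms come from the cuts at m =
  -- K and n = N.
  dot-A : ∀ f q N K → dot (negAvg f) (moment N (alt q)) K
    ≡ dot f (moment N (alt (avg q))) K
      - (cum f (suc K) * moment N (alt (avg q)) K + signedCum q (suc N) * dot (negAvg f) (λ m → C m N) K)
  dot-A f q N zero = base (f 0) (moment N (alt q) 0) (moment N (alt (avg q)) 0) (signedCum q (suc N)) (C 0 N)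
    where
    base : ∀ f y y′ r c → 0ℚ + (- (0ℚ * 0ℚ)) * y ≡ 0ℚ + f * y′ - ((0ℚ + f) * y′ + r * (0ℚ + (- (0ℚ * 0ℚ)) * c))
    base = solve-∀ ℚ-ring
  dot-A f q N (suc K) = begin
    dot (negAvg f) y K + - (v * F) * y (suc K)
      ≡⟨ cong₂ (λ a b → a + - (v * F) * b) (dot-A f q N K) (flip (y (suc K)) (ι (suc K) * (y′ K - y′ (suc K))) (r * c) (moment-A q K N)) ⟩
    D - (F * y′ K + r * E) + - (v * F) * (- (ι (suc K) * (y′ K - y′ (suc K))) - r * c)
      ≡⟨ regroup D F (y′ K) (y′ (suc K)) r E v (ι (suc K)) c ⟩
    D - (F * y′ K + r * E) + ι (suc K) * v * F * (y′ K - y′ (suc K)) + v * F * r * c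
      ≡⟨ cong (λ a → D - (F * y′ K + r * E) + a * F * (y′ K - y′ (suc K)) + v * F * r * c) (ι*inv K) ⟩
    D - (F * y′ K + r * E) + 1ℚ * F * (y′ K - y′ (suc K)) + v * F * r * c
      ≡⟨ collect D F (f (suc K)) (y′ K) (y′ (suc K)) r E v c ⟩
    D + f (suc K) * y′ (suc K) - ((F + f (suc K)) * y′ (suc K) + r * (E + - (v * F) * c)) ∎
    where
    open ≡-Reasoning
    y = moment N (alt q)
    y′ = moment N (alt (avg q))
    D = dot f y′ K
    E = dot (negAvg f) (λ m → C m N) K
    F = cum f (suc K)
    v = inv (suc K)
    r = signedCum q (suc N)
    c = C (suc K) N
    negate : ∀ y r → - (- y - r) - r ≡ y
    negate = solve-∀ ℚ-ring
    flip : ∀ y z r → z ≡ - y - r → y ≡ - z - r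
    flip y z r refl = sym (negate y r)
    regroup : ∀ D F y₀ y₁ r E v i c → D - (F * y₀ + r * E) + - (v * F) * (- (i * (y₀ - y₁)) - r * c)
      ≡ D - (F * y₀ + r * E) + i * v * F * (y₀ - y₁) + v * F * r * c
    regroup = solve-∀ ℚ-ring
    collect : ∀ D F f y₀ y₁ r E v c → D - (F * y₀ + r * E) + 1ℚ * F * (y₀ - y₁) + v * F * r * c
      ≡ D + f * y₁ - ((F + f) * y₁ + r * (E + - (v * F) * c))
    collect = solve-∀ ℚ-ring

  -- The inclusive sum in `avgIncl` shifts the summation by parts by one, so the boundary moment
  -- sits at K+1. With f 0 = 0, the condition for integrating against dx/x, the sum can start at m =
  -- 1; at m = 0 `moment-B` carries the factor 0 and gives no information.
  dot-B : ∀ f q N K → f 0 ≡ 0ℚ → dot (avgIncl f) (moment N (alt q)) K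
    ≡ dot f (moment N (alt (parityAvg q))) K
      - (cum f (suc K) * moment N (alt (parityAvg q)) (suc K)
        - ½ * (parityCum q (suc N) * dot (avgIncl f) (λ m → C m N) K + parityCum q N * dot (avgIncl f) (λ m → C m (suc N)) K))
  dot-B f q N zero f0 rewrite f0 = base (moment N (alt q) 0) (moment N (alt (parityAvg q)) 0) (moment N (alt (parityAvg q)) 1)
      (parityCum q (suc N)) (parityCum q N) (C 0 N) (C 0 (suc N))
    where
    base : ∀ y y₀ y₁ r r′ c c′ → 0ℚ + 0ℚ * (0ℚ + 0ℚ) * y
      ≡ 0ℚ + 0ℚ * y₀ - ((0ℚ + 0ℚ) * y₁ - ½ * (r * (0ℚ + 0ℚ * (0ℚ + 0ℚ) * c) + r′ * (0ℚ + 0ℚ * (0ℚ + 0ℚ) * c′)))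
    base = solve-∀ ℚ-ring
  dot-B f q N (suc K) f0 = begin
    dot (avgIncl f) y K + v * F * y (suc K)
      ≡⟨ cong₂ (λ a b → a + v * F * b) (dot-B f q N K f0) (halve (y (suc K)) (ι (suc K)) (y′ (suc K) - y′ (suc (suc K))) (r * c) (r′ * c′) (moment-B q (suc K) N)) ⟩
    D - (F₀ * y′ (suc K) - ½ * (r * E + r′ * E′)) + v * F * (ι (suc K) * (y′ (suc K) - y′ (suc (suc K))) + ½ * (r * c + r′ * c′))
      ≡⟨ regroup D F₀ (y′ (suc K)) (½ * (r * E + r′ * E′)) v F (ι (suc K)) (y′ (suc K) - y′ (suc (suc K))) (½ * (r * c + r′ * c′)) ⟩
    D - (F₀ * y′ (suc K) - ½ * (r * E + r′ * E′)) + (ι (suc K) * v * F * (y′ (suc K) - y′ (suc (suc K))) + v * F * (½ * (r * c + r′ * c′)))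
      ≡⟨ cong (λ a → D - (F₀ * y′ (suc K) - ½ * (r * E + r′ * E′)) + (a * F * (y′ (suc K) - y′ (suc (suc K))) + v * F * (½ * (r * c + r′ * c′)))) (ι*inv K) ⟩
    D - (F₀ * y′ (suc K) - ½ * (r * E + r′ * E′)) + (1ℚ * F * (y′ (suc K) - y′ (suc (suc K))) + v * F * (½ * (r * c + r′ * c′)))
      ≡⟨ collect D F₀ (f (suc K)) (y′ (suc K)) (y′ (suc (suc K))) r r′ E E′ v c c′ ⟩
    D + f (suc K) * y′ (suc K) - (F * y′ (suc (suc K)) - ½ * (r * (E + v * F * c) + r′ * (E′ + v * F * c′))) ∎
    where
    open ≡-Reasoning
    y = moment N (alt q)
    y′ = moment N (alt (parityAvg q))
    D = dot f y′ K
    E = dot (avgIncl f) (λ m → C m N) K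
    E′ = dot (avgIncl f) (λ m → C m (suc N)) K
    F₀ = cum f (suc K)
    F = cum f (suc (suc K))
    v = inv (suc K)
    r = parityCum q (suc N)
    r′ = parityCum q N
    c = C (suc K) N
    c′ = C (suc K) (suc N)
    half : ∀ y s t → ½ * ((1ℚ + 1ℚ) * y - s - t) + ½ * (s + t) ≡ y
    half = solve-∀ ℚ-ring
    double : ∀ i d → ½ * ((1ℚ + 1ℚ) * i * d) ≡ i * d
    double = solve-∀ ℚ-ring
    halve : ∀ y i d s t → 2ℚ * i * d ≡ 2ℚ * y - s - t → y ≡ i * d + ½ * (s + t)
    halve y i d s t eq = trans (sym (half y s t)) (cong (_+ ½ * (s + t)) (trans (cong (½ *_) (sym eq)) (double i d)))
    regroup : ∀ D F₀ y₀ h v F i d h′ → D - (F₀ * y₀ - h) + v * F * (i * d + h′) ≡ D - (F₀ * y₀ - h) + (i * v * F * d + v * F * h′)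
    regroup = solve-∀ ℚ-ring
    collect : ∀ D F₀ f y₀ y₁ r r′ E E′ v c c′ →
      D - (F₀ * y₀ - ½ * (r * E + r′ * E′)) + (1ℚ * (F₀ + f) * (y₀ - y₁) + v * (F₀ + f) * (½ * (r * c + r′ * c′)))
      ≡ D + f * y₀ - ((F₀ + f) * y₁ - ½ * (r * (E + v * (F₀ + f) * c) + r′ * (E′ + v * (F₀ + f) * c′)))
    collect = solve-∀ ℚ-ring

  -- Error terms of size α (N+1)

  record IsO (x : ℕ → ℚ) : Set where
    constructor mkIsO
    field
      constant : ℚ
      estimate : ∀ N → ∣ x N ∣ ≤ constant * α (suc N)

  IsO-cong : ∀ {x y : ℕ → ℚ} → (∀ N → x N ≡ y N) → IsO x → IsO y
  IsO-cong eq (mkIsO c h) = mkIsO c λ N → subst (λ z → ∣ z ∣ ≤ c * α (suc N)) (eq N) (h N)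

  IsO-neg : ∀ {x : ℕ → ℚ} → IsO x → IsO (λ N → - x N)
  IsO-neg (mkIsO c h) = mkIsO c λ N → ∣-∣≤ (h N)

  IsO-+ : ∀ {x y : ℕ → ℚ} → IsO x → IsO y → IsO (λ N → x N + y N)
  IsO-+ {x} {y} (mkIsO c h) (mkIsO d k) = mkIsO (c + d) λ N → subst (∣ x N + y N ∣ ≤_) (sym (*-distribʳ-+ (α (suc N)) c d)) (∣+∣≤ (h N) (k N))

  IsO-* : ∀ a {x : ℕ → ℚ} → IsO x → IsO (λ N → a * x N)
  IsO-* a {x} (mkIsO c h) = mkIsO (∣ a ∣ * c) λ N → subst (∣ a * x N ∣ ≤_) (sym (*-assoc ∣ a ∣ c (α (suc N)))) (∣*∣≤ {a} ≤-refl (h N))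

  IsO-trans : ∀ {x y z : ℕ → ℚ} → IsO (λ N → x N - y N) → IsO (λ N → y N - z N) → IsO (λ N → x N - z N)
  IsO-trans {x} {y} {z} xy yz = IsO-cong (λ N → telescope (x N) (y N) (z N)) (IsO-+ {λ N → x N - y N} {λ N → y N - z N} xy yz)
    where
    telescope : ∀ a b c → (a - b) + (b - c) ≡ a - c
    telescope = solve-∀ ℚ-ring

  -- 3N terms of the geometrically convergent x-series make its tail negligible.
  cutoff : ℕ → ℕ
  cutoff N = N ℕ.+ (N ℕ.+ N)

  ½^≤2α : ∀ N → ½^ N ≤ 2ℚ * α (suc N)
  ½^≤2α N = ≤-trans (subst (½^ N ≤_) (*-identityʳ (inv (suc N))) (ι*≤⇒≤inv* N (ι*½^≤1 N))) (inv≤2α N)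

  -- This explains the choice of 3N. Two of the three factors `½^ N` absorb the two linear factors,
  -- through (N+1)2⁻ᴺ ≤ 1 and 3N+1 ≤ 3(N+1); the third is at most 1/(N+1), hence at most 2α(N+1).
  tail-bound : ∀ N → ι (suc (cutoff N)) * (ι (suc N) * ½^ (cutoff N)) ≤ (2ℚ + 1ℚ) * 2ℚ * α (suc N)
  tail-bound N = begin
    ι (suc (cutoff N)) * (ι (suc N) * ½^ (cutoff N))
      ≤⟨ *-mono-≤-nonNeg (ι-nonNeg (suc (cutoff N))) ι-cutoff (*-nonNeg (ι-nonNeg (suc N)) (½^-nonNeg (cutoff N))) ≤-refl ⟩
    (2ℚ + 1ℚ) * ι (suc N) * (ι (suc N) * ½^ (cutoff N))
      ≡⟨ cong (λ h → (2ℚ + 1ℚ) * ι (suc N) * (ι (suc N) * h)) (trans (½^-+ N (N ℕ.+ N)) (cong (½^ N *_) (½^-+ N N))) ⟩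
    (2ℚ + 1ℚ) * ι (suc N) * (ι (suc N) * (½^ N * (½^ N * ½^ N)))
      ≡⟨ shuffle (2ℚ + 1ℚ) (ι (suc N)) (½^ N) ⟩
    (2ℚ + 1ℚ) * (ι (suc N) * ½^ N * (ι (suc N) * ½^ N) * ½^ N)
      ≤⟨ *-monoʳ 0≤3 (*-mono-≤-nonNeg (*-nonNeg 0≤s 0≤s) (*-mono-≤-nonNeg 0≤s (ι*½^≤1 N) 0≤s (ι*½^≤1 N)) (½^-nonNeg N) (½^≤2α N)) ⟩
    (2ℚ + 1ℚ) * (1ℚ * 1ℚ * (2ℚ * α (suc N)))
      ≡⟨ cong ((2ℚ + 1ℚ) *_) (*-identityˡ (2ℚ * α (suc N))) ⟩
    (2ℚ + 1ℚ) * (2ℚ * α (suc N))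
      ≡⟨ sym (*-assoc (2ℚ + 1ℚ) 2ℚ (α (suc N))) ⟩
    (2ℚ + 1ℚ) * 2ℚ * α (suc N) ∎
    where
    open ≤-Reasoning
    0≤3 : 0ℚ ≤ 2ℚ + 1ℚ
    0≤3 = +-nonNeg 0≤2 0≤1
    0≤s : 0ℚ ≤ ι (suc N) * ½^ N
    0≤s = *-nonNeg (ι-nonNeg (suc N)) (½^-nonNeg N)
    ι-cutoff : ι (suc (cutoff N)) ≤ (2ℚ + 1ℚ) * ι (suc N)
    ι-cutoff = ≤-by 2ℚ 0≤2 (trans (cong (λ x → x + 1ℚ + 2ℚ) (trans (ι-+ N (N ℕ.+ N)) (cong (ι N +_) (ι-+ N N)))) (triple (ι N)))
      where
      triple : ∀ n → n + (n + n) + 1ℚ + (1ℚ + 1ℚ) ≡ (1ℚ + 1ℚ + 1ℚ) * (n + 1ℚ)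
      triple = solve-∀ ℚ-ring
    shuffle : ∀ t i h → t * i * (i * (h * (h * h))) ≡ t * (i * h * (i * h) * h)
    shuffle = solve-∀ ℚ-ring

  ∣moment∣≤ : ∀ {q} (b : αBounded q) N m → ∣ moment N (alt q) m ∣ ≤ ι (suc N) * (bound b * ½^ m)
  ∣moment∣≤ b N m = ∣cum∣≤ι* (λ n → ∣*∣≤ (∣sgn^*∣≤ n (bounded b n)) (∣nonNeg∣≤ (C-nonNeg m n) (C≤½^ m n))) (suc N)

  tail-IsO : ∀ {f q} → αBounded f → (b : αBounded q) → (s : ℕ → ℕ) → (∀ K → K ℕ.≤ s K) →
    IsO (λ N → cum f (suc (cutoff N)) * moment N (alt q) (s (cutoff N)))
  tail-IsO {f} {q} a b s K≤s = mkIsO (bound a * bound b * ((2ℚ + 1ℚ) * 2ℚ)) λ N → let K = cutoff N in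
    ≤-trans (∣*∣≤ (cum-bounded-ι a (suc K))
        (≤-trans (∣moment∣≤ b N (s K)) (*-monoʳ (ι-nonNeg (suc N)) (*-monoʳ (bound-nonNeg b) (½^-antitone (K≤s K))))))
      (subst₂ _≤_ (shuffle (bound a) (bound b) (ι (suc K)) (ι (suc N)) (½^ K)) (sym (*-assoc (bound a * bound b) ((2ℚ + 1ℚ) * 2ℚ) (α (suc N))))
        (*-monoʳ (*-nonNeg (bound-nonNeg a) (bound-nonNeg b)) (tail-bound N)))
    where
    shuffle : ∀ a b i n h → a * b * (i * (n * h)) ≡ a * i * (n * (b * h))
    shuffle = solve-∀ ℚ-ring

  -- The condition f 0 = 0 removes m = 0, where `C 0 N` is 1 and has no factor 1/(N+1). The
  -- remaining weights form the geometric sum 1 - 2⁻ᴷ, the form kept in the induction.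
  ∣dot-C∣≤ : ∀ {f} (b : αBounded f) → f 0 ≡ 0ℚ → ∀ {c : ℕ → ℚ} N → (∀ m → 0ℚ ≤ c m) → (∀ m → c m ≤ C m N) →
    ∀ K → ∣ dot f c K ∣ ≤ bound b * inv (suc N)
  ∣dot-C∣≤ {f} b f0 {c} N 0≤c c≤C K = ≤-trans (partialSum K) (≤-by (d * ½^ K) (*-nonNeg 0≤d (½^-nonNeg K)) (cancel d (½^ K)))
    where
    d = bound b * inv (suc N)
    0≤d : 0ℚ ≤ d
    0≤d = *-nonNeg (bound-nonNeg b) (inv-nonNeg (suc N))
    cancel : ∀ d h → d * (1ℚ - h) + d * h ≡ d
    cancel = solve-∀ ℚ-ring
    zeroTerm : 0ℚ + f 0 * c 0 ≡ 0ℚ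
    zeroTerm = trans (+-identityˡ (f 0 * c 0)) (trans (cong (_* c 0) f0) (*-zeroˡ (c 0)))
    geometric : ∀ b v h → b * v * (1ℚ - h) + b * (½ * h * v) ≡ b * v * (1ℚ - ½ * h)
    geometric = solve-∀ ℚ-ring
    partialSum : ∀ K → ∣ dot f c K ∣ ≤ d * (1ℚ - ½^ K)
    partialSum zero = ∣0∣≤ zeroTerm (≤-reflexive (sym (*-zeroʳ d)))
    partialSum (suc K) = subst (∣ dot f c (suc K) ∣ ≤_) (geometric (bound b) (inv (suc N)) (½^ K))
      (∣+∣≤ (partialSum K) (∣*∣≤ (bounded b (suc K)) (∣nonNeg∣≤ (0≤c (suc K)) (≤-trans (c≤C (suc K)) (C≤½^*inv K N)))))

  -- The boundary coefficient r is as large as a partial sum of `α`; the factor 1/(N+1) from the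
  -- connector turns it into an average of `α`, which is at most 2α(N+1).
  truncation-IsO : ∀ {f r : ℕ → ℚ} → (b : αBounded f) → f 0 ≡ 0ℚ → ∀ a → (∀ N → ∣ r N ∣ ≤ a * cum α (suc N)) → 0ℚ ≤ a →
    (c : ℕ → ℕ → ℚ) → (∀ N m → 0ℚ ≤ c N m) → (∀ N m → c N m ≤ C m N) →
    IsO (λ N → r N * dot f (c N) (cutoff N))
  truncation-IsO {f} {r} b f0 a r≤ 0≤a c 0≤c c≤C = mkIsO (a * bound b * 2ℚ) λ N → ≤-trans
    (∣*∣≤ {r N} (r≤ N) (∣dot-C∣≤ b f0 N (0≤c N) (c≤C N) (cutoff N)))
    (subst₂ _≤_ (shuffle a (bound b) (cum α (suc N)) (inv (suc N))) (sym (*-assoc (a * bound b) 2ℚ (α (suc N))))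
      (*-monoʳ (*-nonNeg 0≤a (bound-nonNeg b)) (inv*cum-α≤ (suc N))))
    where
    shuffle : ∀ a b s v → a * b * (v * s) ≡ a * s * (b * v)
    shuffle = solve-∀ ℚ-ring

  connected : List Letter → List Letter → ℕ → ℚ
  connected w v N = dot (xCoeff w) (moment N (alt (uCoeff v))) (cutoff N)

  swap-sub : ∀ {x y z} → x ≡ y - z → x - y ≡ - z
  swap-sub {x} {y} {z} refl = cancel y z
    where
    cancel : ∀ y z → y - z - y ≡ - z
    cancel = solve-∀ ℚ-ring

  connected-A : ∀ w v → IsO (λ N → connected (A ∷ w) v N - connected w (A ∷ v) N)
  connected-A w v = IsO-cong (λ N → sym (swap-sub (dot-A (xCoeff w) (uCoeff v) N (cutoff N))))
    (IsO-neg (IsO-+ (tail-IsO (xCoeff-αBounded w) (uCoeff-αBounded (A ∷ v)) (λ K → K) (λ K → ℕ.≤-refl))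
      (truncation-IsO (xCoeff-αBounded (A ∷ w)) (xCoeff-zero A w) (bound b) (λ N → signedCum-bound b (suc N)) (bound-nonNeg b)
        (λ N m → C m N) (λ N m → C-nonNeg m N) (λ N m → ≤-refl))))
    where b = uCoeff-αBounded v

  connected-B : ∀ x w v → IsO (λ N → connected (B ∷ x ∷ w) v N - connected (x ∷ w) (B ∷ v) N)
  connected-B x w v = IsO-cong (λ N → sym (swap-sub (dot-B (xCoeff (x ∷ w)) (uCoeff v) N (cutoff N) (xCoeff-zero x w))))
    (IsO-neg (IsO-+ (tail-IsO (xCoeff-αBounded (x ∷ w)) (uCoeff-αBounded (B ∷ v)) suc ℕ.n≤1+n)
      (IsO-neg (IsO-* ½ (IsO-+
        (truncation (λ N → parityCum-bound b (suc N)) (λ N m → C m N) (λ N m → C-nonNeg m N) (λ N m → ≤-refl))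
        (truncation (λ N → ≤-trans (parityCum-bound b N) (*-monoʳ 0≤2b (≤-+-nonNeg (α-nonNeg N))))
          (λ N m → C m (suc N)) (λ N m → C-nonNeg m (suc N)) (λ N m → C-sucʳ≤ m N)))))))
    where
    b = uCoeff-αBounded v
    0≤2b : 0ℚ ≤ bound b * 2ℚ
    0≤2b = *-nonNeg (bound-nonNeg b) 0≤2
    truncation : ∀ {r : ℕ → ℚ} → (∀ N → ∣ r N ∣ ≤ bound b * 2ℚ * cum α (suc N)) → (c : ℕ → ℕ → ℚ) →
      (∀ N m → 0ℚ ≤ c N m) → (∀ N m → c N m ≤ C m N) → IsO (λ N → r N * dot (xCoeff (B ∷ x ∷ w)) (c N) (cutoff N))
    truncation r≤ = truncation-IsO (xCoeff-αBounded (B ∷ x ∷ w)) (xCoeff-zero B (x ∷ w)) (bound b * 2ℚ) r≤ 0≤2b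

  connected-reverse : ∀ {w} → Admissible w → ∀ v → IsO (λ N → connected w v N - connected [] (w ʳ++ v) N)
  connected-reverse []       v = mkIsO 0ℚ λ N → ∣0∣≤ (+-inverseʳ (connected [] v N)) (*-nonNeg ≤-refl (α-nonNeg (suc N)))
  connected-reverse (A∷_ {w} adm) v = IsO-trans {connected (A ∷ w) v} {connected w (A ∷ v)} {connected [] (w ʳ++ (A ∷ v))} (connected-A w v) (connected-reverse adm (A ∷ v))
  connected-reverse (B∷_ {x} {w} adm) v = IsO-trans {connected (B ∷ x ∷ w) v} {connected (x ∷ w) (B ∷ v)} {connected [] ((x ∷ w) ʳ++ (B ∷ v))} (connected-B x w v) (connected-reverse adm (B ∷ v))

  dot-δ : ∀ y K → dot δ y K ≡ y 0
  dot-δ y zero = trans (+-identityˡ (1ℚ * y 0)) (*-identityˡ (y 0))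
  dot-δ y (suc K) = trans (cong₂ _+_ (dot-δ y K) (*-zeroˡ (y (suc K)))) (+-identityʳ (y 0))

  -- At its two ends the connector evaluates a series: `C 0 n` = 1 is uⁿ at u = 1, and, for the
  -- lemma after this one, `C m 0` = 2⁻ᵐ is xᵐ at x = ½.
  connected-[]ˡ : ∀ v N → connected [] v N ≡ cum (alt (uCoeff v)) (suc N)
  connected-[]ˡ v N = trans (dot-δ (moment N (alt (uCoeff v))) (cutoff N)) (cum-cong (λ n → *-identityʳ (alt (uCoeff v) n)) (suc N))

  connected-[]ʳ : ∀ w N → connected w [] N ≡ dot (xCoeff w) ½^ (cutoff N)
  connected-[]ʳ w N = cum-cong (λ m → cong (xCoeff w m *_) (moment-δ m)) (suc (cutoff N))
    where
    moment-δ : ∀ m → moment N (alt δ) m ≡ ½^ m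
    moment-δ m = trans (cum-cong (λ n → cong (_* C m n) (alt-δ n)) (suc N)) (trans (dot-δ (C m) N) (C-zeroʳ m))
      where
      alt-δ : ∀ n → alt δ n ≡ δ n
      alt-δ zero = refl
      alt-δ (suc n) = *-zeroʳ (sgn^ (suc n))

  -- Euler's transformation of the alternating series

  Δ : ℕ → (ℕ → ℚ) → ℕ → ℚ
  Δ zero x n = x n
  Δ (suc m) x n = Δ m x n - Δ m x (suc n)

  -- Leibniz rule for n · p(n), with the shifted value of `Δ m p` at n+1 eliminated so that only the
  -- point n occurs. Every letter divides by n, and this recovers the differences of p from those of
  -- r.
  Δ-ι* : ∀ {r p : ℕ → ℚ} → (∀ n → r n ≡ ι n * p n) → ∀ m n →
    Δ (suc m) r n ≡ (ι n + ι (suc m)) * Δ (suc m) p n - ι (suc m) * Δ m p n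
  Δ-ι* {r} {p} eq zero n = trans (cong₂ _-_ (eq n) (eq (suc n))) (base (ι n) (p n) (p (suc n)))
    where
    base : ∀ i a b → i * a - (i + 1ℚ) * b ≡ (i + (0ℚ + 1ℚ)) * (a - b) - (0ℚ + 1ℚ) * a
    base = solve-∀ ℚ-ring
  Δ-ι* {r} {p} eq (suc m) n = trans (cong₂ _-_ (Δ-ι* eq m n) (Δ-ι* eq m (suc n)))
    (step (ι n) (ι (suc m)) (Δ m p n) (Δ m p (suc n)) (Δ m p (suc (suc n))))
    where
    step : ∀ i k a b c → (i + k) * (a - b) - k * a - ((i + 1ℚ + k) * (b - c) - k * b) ≡ (i + (k + 1ℚ)) * (a - b - (b - c)) - (k + 1ℚ) * (a - b)
    step = solve-∀ ℚ-ring

  Δ-cum : ∀ x m n → Δ (suc m) (cum x) n ≡ - Δ m x n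
  Δ-cum x zero n = base (cum x n) (x n)
    where
    base : ∀ s a → s - (s + a) ≡ - a
    base = solve-∀ ℚ-ring
  Δ-cum x (suc m) n = trans (cong₂ _-_ (Δ-cum x m n) (Δ-cum x m (suc n))) (step (Δ m x n) (Δ m x (suc n)))
    where
    step : ∀ a b → - a - - b ≡ - (a - b)
    step = solve-∀ ℚ-ring

  cum≡ι*avg : ∀ x n → cum x n ≡ ι n * avg x n
  cum≡ι*avg x zero = refl
  cum≡ι*avg x (suc n) = sym (ι*[inv* cum x (suc n) ]≡ n)

  tCoeff≡ι*tCoeff-B : ∀ x w n → tCoeff (x ∷ w) n ≡ ι n * tCoeff (B ∷ x ∷ w) n
  tCoeff≡ι*tCoeff-B x w zero = trans (tCoeff-zero x w) (sym (*-zeroˡ (tCoeff (B ∷ x ∷ w) 0)))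
  tCoeff≡ι*tCoeff-B x w (suc n) = sym (ι*[inv* tCoeff (x ∷ w) (suc n) ]≡ n)

  -- The constant is uniform in the order m, as Euler's boundary terms at N+1 are summed over all m
  -- with weights 2⁻ᵐ⁻¹. The point 0 is left out: for the word `A` the m-th difference there is
  -- minus the m-th harmonic number.
  Δ-αBounded : (ℕ → ℚ) → Set
  Δ-αBounded x = ∃ λ c → 0ℚ ≤ c × (∀ m n → ∣ Δ m x (suc n) ∣ ≤ c * α (suc n))

  -- Only differences of r of positive order are assumed small, since for the letter `A` r is a
  -- partial sum and need not be O(α).
  Δ-αBounded-ι* : ∀ {r p : ℕ → ℚ} → (∀ n → r n ≡ ι n * p n) → αBounded p → ∀ c → 0ℚ ≤ c →
    (∀ m n → ∣ Δ (suc m) r (suc n) ∣ ≤ c * α (suc n)) → Δ-αBounded p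
  Δ-αBounded-ι* {r} {p} eq b c 0≤c r≤ = d , 0≤d , p≤
    where
    -- The summand `bound b` covers order 0. Since c ≤ d, the induction closes through c + k·d ≤
    -- (n+1+k)·d with k = m+1; the 1 on the right is where the point n+1 ≥ 1 enters.
    d = c + bound b
    0≤d : 0ℚ ≤ d
    0≤d = +-nonNeg 0≤c (bound-nonNeg b)
    solveFor : ∀ i k x y z → z ≡ (i + k) * x - k * y → (i + k) * x ≡ z + k * y
    solveFor i k x y z refl = cancel ((i + k) * x) (k * y)
      where
      cancel : ∀ s t → s ≡ s - t + t
      cancel = solve-∀ ℚ-ring
    p≤ : ∀ m n → ∣ Δ m p (suc n) ∣ ≤ d * α (suc n)
    p≤ zero n = ≤-trans (holds b (suc n)) (*-mono-≤-nonNeg (bound-nonNeg b)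
      (subst (_≤ d) (+-identityˡ (bound b)) (+-monoˡ-≤ (bound b) 0≤c)) (α-nonNeg (suc n)) ≤-refl)
    p≤ (suc m) n = *-cancel-∣∣≤ {ι (suc n) + ι (suc m)} (+-mono-<-≤ (ι-pos n) (ι-nonNeg (suc m)))
      (subst (λ z → ∣ z ∣ ≤ (ι (suc n) + ι (suc m)) * (d * α (suc n)))
        (sym (solveFor (ι (suc n)) (ι (suc m)) (Δ (suc m) p (suc n)) (Δ m p (suc n)) (Δ (suc m) r (suc n)) (Δ-ι* eq m (suc n))))
        (≤-trans (∣+∣≤ (r≤ m n) (∣*∣≤ (∣nonNeg∣≤ (ι-nonNeg (suc m)) ≤-refl) (p≤ m n)))
          (≤-by (bound b * α (suc n) + ι n * (d * α (suc n)))
            (+-nonNeg (*-nonNeg (bound-nonNeg b) (α-nonNeg (suc n))) (*-nonNeg (ι-nonNeg n) (*-nonNeg 0≤d (α-nonNeg (suc n)))))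
            (collect c (bound b) (α (suc n)) (ι n) (ι (suc m))))))
      where
      collect : ∀ c b a i k → c * a + k * ((c + b) * a) + (b * a + i * ((c + b) * a)) ≡ (i + 1ℚ + k) * ((c + b) * a)
      collect = solve-∀ ℚ-ring

  Δδ-zero : ∀ m n → Δ m δ (suc n) ≡ 0ℚ
  Δδ-zero zero n = refl
  Δδ-zero (suc m) n = cong₂ _-_ (Δδ-zero m n) (Δδ-zero m (suc n))

  Δ-tCoeff-αBounded : ∀ {w} → Admissible w → Δ-αBounded (tCoeff w)
  Δ-tCoeff-αBounded [] = 0ℚ , ≤-refl , λ m n → ∣0∣≤ (Δδ-zero m n) (*-nonNeg ≤-refl (α-nonNeg (suc n)))
  Δ-tCoeff-αBounded (A∷_ {w} adm) = let c , 0≤c , h = Δ-tCoeff-αBounded adm in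
    Δ-αBounded-ι* (cum≡ι*avg (tCoeff w)) (tCoeff-αBounded (A ∷ w)) c 0≤c
      λ m n → subst (λ z → ∣ z ∣ ≤ c * α (suc n)) (sym (Δ-cum (tCoeff w) m (suc n))) (∣-∣≤ (h m n))
  Δ-tCoeff-αBounded (B∷_ {x} {w} adm) = let c , 0≤c , h = Δ-tCoeff-αBounded adm in
    Δ-αBounded-ι* (tCoeff≡ι*tCoeff-B x w) (tCoeff-αBounded (B ∷ x ∷ w)) c 0≤c λ m → h (suc m)

  Δ-suc-zero : ∀ {r p : ℕ → ℚ} → (∀ n → r n ≡ ι n * p n) → ∀ m → Δ (suc m) p 0 ≡ Δ m p 0 + inv (suc m) * Δ (suc m) r 0
  Δ-suc-zero {r} {p} eq m = sym (begin
    P₀ + v * Δ (suc m) r 0             ≡⟨ cong (λ z → P₀ + v * z) (Δ-ι* eq m 0) ⟩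
    P₀ + v * ((0ℚ + k) * P₁ - k * P₀)  ≡⟨ shuffle P₀ P₁ k v ⟩
    P₀ + k * v * (P₁ - P₀)             ≡⟨ cong (λ z → P₀ + z * (P₁ - P₀)) (ι*inv m) ⟩
    P₀ + 1ℚ * (P₁ - P₀)                ≡⟨ cancel P₀ P₁ ⟩
    P₁                                 ∎)
    where
    open ≡-Reasoning
    P₀ = Δ m p 0
    P₁ = Δ (suc m) p 0
    k = ι (suc m)
    v = inv (suc m)
    shuffle : ∀ a b k v → a + v * ((0ℚ + k) * b - k * a) ≡ a + k * v * (b - a)
    shuffle = solve-∀ ℚ-ring
    cancel : ∀ a b → a + 1ℚ * (b - a) ≡ b
    cancel = solve-∀ ℚ-ring

  -- Euler's transformation rewrites Σ (-1)ⁿ t(n) tⁿ as (1-x) Σ Δᵐt(0) xᵐ; dividing by 1-x takes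
  -- partial sums of the x-coefficients. The induction matches the recursion of `xCoeff` with
  -- `Δ-suc-zero`.
  cum-xCoeff≡Δ : ∀ {w} → Admissible w → ∀ m → cum (xCoeff w) (suc m) ≡ Δ m (tCoeff w) 0
  cum-xCoeff≡Δ [] zero = refl
  cum-xCoeff≡Δ [] (suc m) = cong₂ _-_ (cum-xCoeff≡Δ [] m) (sym (Δδ-zero m 0))
  cum-xCoeff≡Δ (A∷ adm) zero = refl
  cum-xCoeff≡Δ (A∷_ {w} adm) (suc m) = sym (begin
    Δ (suc m) (avg t) 0                                ≡⟨ Δ-suc-zero (cum≡ι*avg t) m ⟩
    Δ m (avg t) 0 + inv (suc m) * Δ (suc m) (cum t) 0  ≡⟨ cong₂ (λ x y → x + inv (suc m) * y) (sym (cum-xCoeff≡Δ (A∷ adm) m))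
                                                            (trans (Δ-cum t m 0) (cong -_ (sym (cum-xCoeff≡Δ adm m)))) ⟩
    X + inv (suc m) * - cum (xCoeff w) (suc m)         ≡⟨ cong (X +_) (sym (neg-distribʳ-* (inv (suc m)) (cum (xCoeff w) (suc m)))) ⟩
    X + - avg (xCoeff w) (suc m)                       ∎)
    where
    open ≡-Reasoning
    t = tCoeff w
    X = cum (xCoeff (A ∷ w)) (suc m)
  cum-xCoeff≡Δ (B∷_ {x} {w} adm) zero = trans (+-identityˡ (xCoeff (B ∷ x ∷ w) 0)) (trans (xCoeff-zero B (x ∷ w)) (sym (tCoeff-zero B (x ∷ w))))
  cum-xCoeff≡Δ (B∷_ {x} {w} adm) (suc m) = sym (trans (Δ-suc-zero (tCoeff≡ι*tCoeff-B x w) m)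
    (cong₂ (λ a b → a + inv (suc m) * b) (sym (cum-xCoeff≡Δ (B∷ adm) m)) (sym (cum-xCoeff≡Δ adm (suc m)))))

  xCoeff-suc : ∀ {w} → Admissible w → ∀ m → xCoeff w (suc m) ≡ - Δ m (tCoeff w) 1
  xCoeff-suc {w} adm m = begin
    xCoeff w (suc m)                                         ≡⟨ difference (cum (xCoeff w) (suc m)) (xCoeff w (suc m)) ⟩
    cum (xCoeff w) (suc (suc m)) - cum (xCoeff w) (suc m)    ≡⟨ cong₂ _-_ (cum-xCoeff≡Δ adm (suc m)) (cum-xCoeff≡Δ adm m) ⟩
    Δ m (tCoeff w) 0 - Δ m (tCoeff w) 1 - Δ m (tCoeff w) 0   ≡⟨ cancel (Δ m (tCoeff w) 0) (Δ m (tCoeff w) 1) ⟩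
    - Δ m (tCoeff w) 1                                       ∎
    where
    open ≡-Reasoning
    difference : ∀ s a → a ≡ s + a - s
    difference = solve-∀ ℚ-ring
    cancel : ∀ a b → a - b - a ≡ - b
    cancel = solve-∀ ℚ-ring

  -- Since (-1)ⁿ(y(n) - y(n+1)) adds neighbouring terms with their alternating signs, each inner
  -- term is counted twice. Solved for the sum of lower order, this is one step of Euler's
  -- transformation.
  sum1-alt-Δ : ∀ t m N → sum1 N (alt (Δ (suc m) t))
    ≡ sum1 N (alt (Δ m t)) + sum1 N (alt (Δ m t)) + Δ m t 1 + sgn^ (suc N) * Δ m t (suc N)
  sum1-alt-Δ t m zero = base (Δ m t 1)
    where
    base : ∀ a → 0ℚ ≡ 0ℚ + 0ℚ + a + - 1ℚ * 1ℚ * a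
    base = solve-∀ ℚ-ring
  sum1-alt-Δ t m (suc N) = trans (cong (_+ alt (Δ (suc m) t) (suc N)) (sum1-alt-Δ t m N))
    (step (sum1 N (alt (Δ m t))) (Δ m t 1) (sgn^ (suc N)) (Δ m t (suc N)) (Δ m t (suc (suc N))))
    where
    step : ∀ s a e x y → s + s + a + e * x + e * (x - y) ≡ s + e * x + (s + e * x) + a + - 1ℚ * e * y
    step = solve-∀ ℚ-ring

  boundary : (ℕ → ℚ) → ℕ → ℕ → ℚ
  boundary t N m = ½^ (suc m) * (sgn^ (suc N) * Δ m t (suc N))

  -- The K-fold iteration with its exact remainder: the lower ends -2⁻ᵐ⁻¹ Δᵐt(1) are the terms of
  -- the x-series at ½, the upper ends form `boundary`, and 2⁻ᴷ multiplies the last alternating sum.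
  euler : ∀ {x w} → Admissible (x ∷ w) → ∀ N K → let t = tCoeff (x ∷ w) in
    sum1 N (alt t) ≡ dot (xCoeff (x ∷ w)) ½^ K - (cum (boundary t N) K - ½^ K * sum1 N (alt (Δ K t)))
  euler {x} {w} adm N zero = trans (base (sum1 N (alt (tCoeff (x ∷ w)))))
    (cong (λ z → 0ℚ + z * 1ℚ - (0ℚ - 1ℚ * sum1 N (alt (tCoeff (x ∷ w))))) (sym (xCoeff-zero x w)))
    where
    base : ∀ s → s ≡ 0ℚ + 0ℚ * 1ℚ - (0ℚ - 1ℚ * s)
    base = solve-∀ ℚ-ring
  euler {x} {w} adm N (suc K) = begin
    sum1 N (alt t)                                                               ≡⟨ euler adm N K ⟩
    D - (E - h * S)                                                              ≡⟨ step D E h S (Δ K t 1) b ⟩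
    D + - Δ K t 1 * (½ * h) - (E + ½ * h * b - ½ * h * (S + S + Δ K t 1 + b))    ≡⟨ cong₂ (λ y z → D + y * (½ * h) - (E + ½ * h * b - ½ * h * z))
                                                                                      (sym (xCoeff-suc adm K)) (sym (sum1-alt-Δ t K N)) ⟩
    D + xCoeff (x ∷ w) (suc K) * (½ * h) - (E + ½ * h * b - ½ * h * sum1 N (alt (Δ (suc K) t))) ∎
    where
    open ≡-Reasoning
    t = tCoeff (x ∷ w)
    D = dot (xCoeff (x ∷ w)) ½^ K
    E = cum (boundary t N) K
    h = ½^ K
    S = sum1 N (alt (Δ K t))
    b = sgn^ (suc N) * Δ K t (suc N)
    step : ∀ D E h S a b → D - (E - h * S) ≡ D + - a * (½ * h) - (E + ½ * h * b - ½ * h * (S + S + a + b))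
    step = solve-∀ ℚ-ring

  ∣cum-½^∣≤ : ∀ {y : ℕ → ℚ} {d} → 0ℚ ≤ d → (∀ m → ∣ y m ∣ ≤ d) → ∀ K → ∣ cum (λ m → ½^ (suc m) * y m) K ∣ ≤ d
  ∣cum-½^∣≤ {y} {d} 0≤d y≤ K = ≤-trans (partialSum K) (≤-by (d * ½^ K) (*-nonNeg 0≤d (½^-nonNeg K)) (cancel d (½^ K)))
    where
    cancel : ∀ d h → d * (1ℚ - h) + d * h ≡ d
    cancel = solve-∀ ℚ-ring
    geometric : ∀ d h → d * (1ℚ - h) + ½ * h * d ≡ d * (1ℚ - ½ * h)
    geometric = solve-∀ ℚ-ring
    partialSum : ∀ K → ∣ cum (λ m → ½^ (suc m) * y m) K ∣ ≤ d * (1ℚ - ½^ K)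
    partialSum zero = ≤-reflexive (sym (*-zeroʳ d))
    partialSum (suc K) = subst (∣ cum (λ m → ½^ (suc m) * y m) (suc K) ∣ ≤_) (geometric d (½^ K))
      (∣+∣≤ (partialSum K) (∣*∣≤ (∣nonNeg∣≤ (½^-nonNeg (suc K)) ≤-refl) (y≤ K)))

  ∣sum1∣≤ι* : ∀ {x c} → (∀ j → ∣ x (suc j) ∣ ≤ c) → ∀ n → ∣ sum1 n x ∣ ≤ ι n * c
  ∣sum1∣≤ι* {x} {c} le zero = ≤-reflexive (sym (*-zeroˡ c))
  ∣sum1∣≤ι* {x} {c} le (suc n) = subst (∣ sum1 (suc n) x ∣ ≤_) (factor (ι n) c) (∣+∣≤ (∣sum1∣≤ι* le n) (le n))
    where
    factor : ∀ a c → a * c + c ≡ (a + 1ℚ) * c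
    factor = solve-∀ ℚ-ring

  euler-IsO : ∀ {x w} → Admissible (x ∷ w) → IsO (λ N → sum1 N (alt (tCoeff (x ∷ w))) - dot (xCoeff (x ∷ w)) ½^ (cutoff N))
  euler-IsO {x} {w} adm = let c , 0≤c , h = Δ-tCoeff-αBounded adm in
    IsO-cong (λ N → sym (swap-sub (euler adm N (cutoff N))))
      (IsO-neg (IsO-+ (mkIsO c λ N → ∣cum-½^∣≤ (*-nonNeg 0≤c (α-nonNeg (suc N))) (λ m → ∣sgn^*∣≤ (suc N) (h m N)) (cutoff N))
        (IsO-neg (mkIsO (c * ((2ℚ + 1ℚ) * 2ℚ)) λ N → remainder c 0≤c h N))))
    where
    t = tCoeff (x ∷ w)
    shuffle : ∀ c i j h → c * (j * (i * h)) ≡ j * h * (i * c)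
    shuffle = solve-∀ ℚ-ring
    remainder : ∀ c → 0ℚ ≤ c → (∀ m n → ∣ Δ m t (suc n) ∣ ≤ c * α (suc n)) → ∀ N →
      ∣ ½^ (cutoff N) * sum1 N (alt (Δ (cutoff N) t)) ∣ ≤ c * ((2ℚ + 1ℚ) * 2ℚ) * α (suc N)
    remainder c 0≤c h N = ≤-trans
      (∣*∣≤ (∣nonNeg∣≤ (½^-nonNeg K) half≤) (∣sum1∣≤ι* (λ j → ∣sgn^*∣≤ (suc j) (Δ≤ j)) N))
      (≤-trans (*-monoʳ (*-nonNeg (ι-nonNeg (suc K)) (½^-nonNeg K)) (*-mono-≤-nonNeg (ι-nonNeg N) (ι-mono (ℕ.n≤1+n N)) 0≤c ≤-refl))
        (subst₂ _≤_ (shuffle c (ι (suc N)) (ι (suc K)) (½^ K)) (sym (*-assoc c ((2ℚ + 1ℚ) * 2ℚ) (α (suc N)))) (*-monoʳ 0≤c (tail-bound N))))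
      where
      K = cutoff N
      half≤ : ½^ K ≤ ι (suc K) * ½^ K
      half≤ = ≤-by (ι K * ½^ K) (*-nonNeg (ι-nonNeg K) (½^-nonNeg K)) (expand (ι K) (½^ K))
        where
        expand : ∀ i h → h + i * h ≡ (i + 1ℚ) * h
        expand = solve-∀ ℚ-ring
      Δ≤ : ∀ j → ∣ Δ K t (suc j) ∣ ≤ c
      Δ≤ j = ≤-trans (h K j) (subst (c * α (suc j) ≤_) (*-identityʳ c) (*-monoʳ 0≤c (α≤1 (suc j))))

  -- Limits

  archimedean : ∀ x → ∃ λ N → x < ι N
  archimedean x@(mkℚ n d-1 _) = N , subst (x <_) (sym (ι≡fraction N)) (toℚᵘ-cancel-<
    (ℚᵘ.<-respʳ-≃ (ℚᵘ.≃-sym (toℚᵘ-fromℚᵘ (mkℚᵘ (pos N) 0))) (*<* (begin-strict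
      n ℤ.* pos 1              ≡⟨ ℤ.*-identityʳ n ⟩
      n                      ≤⟨ i≤∣i∣ n ⟩
      pos ℤ.∣ n ∣              <⟨ ℤ.+<+ (ℕ.n<1+n ℤ.∣ n ∣) ⟩
      pos N                    ≤⟨ ℤ.+≤+ (ℕ.m≤m*n N (suc d-1)) ⟩
      pos (N ℕ.* suc d-1)      ≡⟨ ℤ.pos-* N (suc d-1) ⟩
      pos N ℤ.* pos (suc d-1)    ∎))))
    where
    open ℤ.≤-Reasoning
    N = suc ℤ.∣ n ∣
    i≤∣i∣ : ∀ i → i ℤ.≤ pos ℤ.∣ i ∣
    i≤∣i∣ (pos k) = ℤ.≤-refl
    i≤∣i∣ (ℤ.-[1+ k ]) = ℤ.-≤+

  archimedean-* : ∀ x y → 0ℚ < y → ∃ λ N → x < y * ι N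
  archimedean-* x y 0<y = let N , x/y<N = archimedean (x * y⁻¹) in
    N , subst (_< y * ι N) (trans (shuffle x y y⁻¹) (trans (cong (_* x) (*-inverseʳ y)) (*-identityˡ x))) (*-monoʳ-<-pos y x/y<N)
    where
    instance
      _ = positive 0<y
      _ = pos⇒nonZero y
    y⁻¹ = 1/ y
    shuffle : ∀ x y z → y * (x * z) ≡ y * z * x
    shuffle = solve-∀ ℚ-ring

  α-tendsToZero : ∀ c ε → 0ℚ < ε → ∃ λ N₀ → ∀ N → N₀ ℕ.≤ N → c * α (suc N) < ε
  -- `N₀` satisfies c² < ε²N₀. Comparing squares through `α²-bound` avoids the square root in the
  -- size of `α`.
  α-tendsToZero c ε 0<ε = let N₀ , large = archimedean-* (d * d) (ε * ε) (positive⁻¹ (ε * ε) {{pos*pos⇒pos ε {{positive 0<ε}} ε {{positive 0<ε}}}}) in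
    N₀ , λ N N₀≤N → ≰⇒> λ ε≤cα → <-irrefl refl (<-≤-trans large (small N₀ N N₀≤N ε≤cα))
    where
    d = ∣ c ∣
    c≤d : c ≤ d
    c≤d = c≤∣c∣ (≤-total 0ℚ c)
      where
      c≤∣c∣ : 0ℚ ≤ c ⊎ c ≤ 0ℚ → c ≤ ∣ c ∣
      c≤∣c∣ (inj₁ 0≤c) = ≤-reflexive (sym (0≤p⇒∣p∣≡p 0≤c))
      c≤∣c∣ (inj₂ c≤0) = ≤-trans c≤0 (0≤∣p∣ c)
    rearrange : ∀ d a k → d * a * (d * a) * k ≡ d * d * (a * a * k)
    rearrange = solve-∀ ℚ-ring
    small : ∀ N₀ N → N₀ ℕ.≤ N → ε ≤ c * α (suc N) → ε * ε * ι N₀ ≤ d * d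
    small N₀ N N₀≤N ε≤cα = begin
      ε * ε * ι N₀                                     ≤⟨ *-mono-≤-nonNeg (*-nonNeg 0≤ε 0≤ε) (*-mono-≤-nonNeg 0≤ε ε≤da 0≤ε ε≤da) (ι-nonNeg N₀) ι≤ ⟩
      d * a * (d * a) * (2ℚ * ι (suc N) + 1ℚ)          ≡⟨ rearrange d a (2ℚ * ι (suc N) + 1ℚ) ⟩
      d * d * (a * a * (2ℚ * ι (suc N) + 1ℚ))          ≤⟨ *-monoʳ (*-nonNeg (0≤∣p∣ c) (0≤∣p∣ c)) (α²-bound (suc N)) ⟩
      d * d * 1ℚ                                       ≡⟨ *-identityʳ (d * d) ⟩
      d * d                                            ∎
      where
      open ≤-Reasoning
      a = α (suc N)
      0≤ε : 0ℚ ≤ ε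
      0≤ε = <⇒≤ 0<ε
      ε≤da : ε ≤ d * a
      ε≤da = ≤-trans ε≤cα (*-monoʳ-≤-nonNeg a {{nonNegative (α-nonNeg (suc N))}} c≤d)
      ι≤ : ι N₀ ≤ 2ℚ * ι (suc N) + 1ℚ
      ι≤ = ≤-trans (ι-mono N₀≤N) (≤-by (ι N + 2ℚ + 1ℚ) (+-nonNeg (+-nonNeg (ι-nonNeg N) 0≤2) 0≤1) (expand (ι N)))
        where
        expand : ∀ n → n + (n + (1ℚ + 1ℚ) + 1ℚ) ≡ (1ℚ + 1ℚ) * (n + 1ℚ) + 1ℚ
        expand = solve-∀ ℚ-ring

  IsO⇒tendsToZero : ∀ {x} → IsO x → TendsToZero x
  IsO⇒tendsToZero (mkIsO c h) ε 0<ε = let N₀ , small = α-tendsToZero c ε 0<ε in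
    N₀ , λ N N₀≤N → ≤-<-trans (h N) (small N N₀≤N)

  dot-½^-tail : ∀ {f} (b : αBounded f) {K L} → K ℕ.≤ L → ∣ dot f ½^ L - dot f ½^ K ∣ ≤ bound b * (½^ K - ½^ L)
  dot-½^-tail {f} b {K} K≤L = go (ℕ.≤⇒≤′ K≤L)
    where
    regroup : ∀ x y z → x + y - z ≡ x - z + y
    regroup = solve-∀ ℚ-ring
    geometric : ∀ b h k → b * (h - k) + b * (½ * k) ≡ b * (h - ½ * k)
    geometric = solve-∀ ℚ-ring
    go : ∀ {L} → K ℕ.≤′ L → ∣ dot f ½^ L - dot f ½^ K ∣ ≤ bound b * (½^ K - ½^ L)
    go (ℕ.≤′-reflexive refl) = ∣0∣≤ (+-inverseʳ (dot f ½^ K)) (≤-reflexive (sym (trans (cong (bound b *_) (+-inverseʳ (½^ K))) (*-zeroʳ (bound b)))))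
    go (ℕ.≤′-step {L} K≤L) = subst₂ (λ x y → ∣ x ∣ ≤ y)
      (sym (regroup (dot f ½^ L) (f (suc L) * ½^ (suc L)) (dot f ½^ K))) (geometric (bound b) (½^ K) (½^ L))
      (∣+∣≤ (go K≤L) (∣*∣≤ (bounded b (suc L)) (∣nonNeg∣≤ (½^-nonNeg (suc L)) ≤-refl)))

  cutoff-mono : ∀ {M N} → M ℕ.≤ N → cutoff M ℕ.≤ cutoff N
  cutoff-mono M≤N = ℕ.+-mono-≤ M≤N (ℕ.+-mono-≤ M≤N M≤N)

  -- Convergence is inherited from the x-series at ½, which has bounded coefficients and therefore a
  -- geometric tail.
  IsO-dot-½^⇒cauchy : ∀ {x f} → αBounded f → IsO (λ N → x N - dot f ½^ (cutoff N)) → Cauchy x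
  IsO-dot-½^⇒cauchy {x} {f} b (mkIsO c h) ε 0<ε = let N₀ , small = α-tendsToZero (c + c + bound b * 2ℚ) ε 0<ε in
    N₀ , λ M N N₀≤M N₀≤N → compare M N (small M N₀≤M) (small N N₀≤N) (ℕ.≤-total M N)
    where
    y : ℕ → ℚ
    y N = dot f ½^ (cutoff N)
    split : ∀ a a′ b b′ → a - a′ ≡ a - b + - (a′ - b′) + - (b′ - b)
    split = solve-∀ ℚ-ring
    factor : ∀ a c e → c * a + c * a + e * (1ℚ + 1ℚ) * a ≡ (c + c + e * (1ℚ + 1ℚ)) * a
    factor = solve-∀ ℚ-ring
    α-antitone : ∀ {M N} → M ℕ.≤ N → α N ≤ α M
    α-antitone {M} M≤N = go (ℕ.≤⇒≤′ M≤N)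
      where
      go : ∀ {N} → M ℕ.≤′ N → α N ≤ α M
      go (ℕ.≤′-reflexive refl) = ≤-refl
      go (ℕ.≤′-step {N} le) = ≤-trans (α-suc≤ N) (go le)
    0≤c : 0ℚ ≤ c
    -- `α 1` evaluates to ½, so the estimate at N = 0 forces c to be nonnegative.
    0≤c = *-cancelˡ-≤-pos {0ℚ} {c} (α 1) {{positive (positive⁻¹ ½)}}
      (subst₂ _≤_ (sym (*-zeroʳ (α 1))) (*-comm c (α 1)) (≤-trans (0≤∣p∣ (x 0 - y 0)) (h 0)))
    tail≤ : ∀ {M N} → M ℕ.≤ N → ∣ y N - y M ∣ ≤ bound b * 2ℚ * α (suc M)
    tail≤ {M} {N} M≤N = ≤-trans (dot-½^-tail b (cutoff-mono M≤N)) (≤-trans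
      (*-monoʳ (bound-nonNeg b) (≤-trans
        (≤-by (½^ (cutoff N)) (½^-nonNeg (cutoff N)) (cancel (½^ (cutoff M)) (½^ (cutoff N))))
        (≤-trans (½^-antitone (ℕ.m≤m+n M (M ℕ.+ M))) (½^≤2α M))))
      (≤-reflexive (sym (*-assoc (bound b) 2ℚ (α (suc M))))))
      where
      cancel : ∀ h k → h - k + k ≡ h
      cancel = solve-∀ ℚ-ring
    close : ∀ {M N} → M ℕ.≤ N → ∣ x M - x N ∣ ≤ (c + c + bound b * 2ℚ) * α (suc M)
    close {M} {N} M≤N = subst₂ (λ z e → ∣ z ∣ ≤ e) (sym (split (x M) (x N) (y M) (y N))) (factor (α (suc M)) c (bound b))
      (∣+∣≤ (∣+∣≤ (h M) (∣-∣≤ (≤-trans (h N) (*-monoʳ 0≤c (α-antitone (ℕ.s≤s M≤N)))))) (∣-∣≤ (tail≤ M≤N)))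
    swap : ∀ a b → - (a - b) ≡ b - a
    swap = solve-∀ ℚ-ring
    compare : ∀ M N → _ → _ → _ → ∣ x M - x N ∣ < ε
    compare M N smallM smallN (inj₁ M≤N) = ≤-<-trans (close M≤N) smallM
    compare M N smallM smallN (inj₂ N≤M) = ≤-<-trans (subst (λ z → ∣ z ∣ ≤ (c + c + bound b * 2ℚ) * α (suc N)) (swap (x N) (x M)) (∣-∣≤ (close N≤M))) smallN

open Estimates
open import Data.Nat using (_≤_)

-- Words attached to the indices

-- An entry 2 is the pair `B A`. Its `A` is merged with the ones that follow, so the index becomes
-- A^m₁ B A^m₂ B ... A^mₖ₊₁, and reversing the word just reverses the exponents.
wordTail : List ℕ → List Letter
wordTail [] = []
wordTail (m ∷ ms) = B ∷ replicate m A ++ wordTail ms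

word : List ℕ → List Letter
word [] = []
word (m ∷ ms) = replicate m A ++ wordTail ms

replicate-ʳ++ : ∀ n (x : Letter) ys → replicate n x ʳ++ ys ≡ replicate n x ++ ys
replicate-ʳ++ zero x ys = refl
replicate-ʳ++ (suc n) x ys = trans (replicate-ʳ++ n x (x ∷ ys)) (shift n)
  where
  shift : ∀ n → replicate n x ++ x ∷ ys ≡ x ∷ replicate n x ++ ys
  shift zero = refl
  shift (suc n) = cong (x ∷_) (shift n)

wordTail-ʳ++ : ∀ ms n ns → wordTail ms ʳ++ word (n ∷ ns) ≡ word (ms ʳ++ (n ∷ ns))
wordTail-ʳ++ [] n ns = refl
wordTail-ʳ++ (m ∷ ms) n ns = trans (++-ʳ++ (replicate m A))
  (trans (cong (wordTail ms ʳ++_) (replicate-ʳ++ m A (B ∷ word (n ∷ ns)))) (wordTail-ʳ++ ms m (n ∷ ns)))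

reverse-word : ∀ ms → reverse (word ms) ≡ word (reverse ms)
reverse-word [] = refl
reverse-word (m ∷ ms) = trans (++-ʳ++ (replicate m A))
  (trans (cong (wordTail ms ʳ++_) (replicate-ʳ++ m A [])) (wordTail-ʳ++ ms m []))

admissible-replicate : ∀ n {w} → Admissible w → Admissible (replicate n A ++ w)
admissible-replicate zero adm = adm
admissible-replicate (suc n) adm = A∷ admissible-replicate n adm

wordTail-admissible : ∀ {ms} → All (1 ≤_) ms → Admissible (wordTail ms)
wordTail-admissible [] = []
wordTail-admissible (ℕ.s≤s {n = d} _ ∷ all) = B∷ (A∷ admissible-replicate d (wordTail-admissible all))

-- Nested sums as operators on their innermost summand

nestedOn : List Entry → (ℕ → ℚ) → ℕ → ℚ
nestedOn [] x b = x b
nestedOn (e ∷ es) x b = sum1 (b ∸ 1) (λ n → term e n * nestedOn es x n)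

nested-++ : ∀ es fs b → nested b (es ++ fs) ≡ nestedOn es (λ n → nested n fs) b
nested-++ [] fs b = refl
nested-++ (e ∷ es) fs b = sum1-cong (λ j → cong (term e (suc j) *_) (nested-++ es fs (suc j))) (b ∸ 1)

nestedOn-cong : ∀ es {x y} → (∀ n → x (suc n) ≡ y (suc n)) → ∀ n → nestedOn es x (suc n) ≡ nestedOn es y (suc n)
nestedOn-cong [] eq n = eq n
nestedOn-cong (e ∷ es) eq n = sum1-cong (λ j → cong (term e (suc j) *_) (nestedOn-cong es eq j)) n

pow-1 : ∀ n → pow 1ℚ n ≡ 1ℚ
pow-1 zero = refl
pow-1 (suc n) = trans (*-identityˡ (pow 1ℚ n)) (pow-1 n)

term-⊕1 : ∀ n → term (⊕ , 1) n ≡ inv n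
term-⊕1 n = trans (cong₂ _*_ (pow-1 n) (*-identityʳ (inv n))) (*-identityˡ (inv n))

term-⊖1 : ∀ n → term (⊖ , 1) n ≡ sgn^ n * inv n
term-⊖1 n = cong (sgn^ n *_) (*-identityʳ (inv n))

term-⊕2 : ∀ n → term (⊕ , 2) n ≡ inv n * inv n
term-⊕2 n = trans (cong₂ _*_ (pow-1 n) (cong (inv n *_) (*-identityʳ (inv n)))) (*-identityˡ (inv n * inv n))

-- The convention `inv 0` = 0 removes the summand at 0, so the sum from 0 agrees with the nested-sum
-- convention from 1.
cum-avg : ∀ x n → cum (avg x) (suc n) ≡ sum1 n (avg x)
cum-avg x = cum-suc≡sum1 (avg x) refl

cum-alt-avg : ∀ x n → cum (alt (avg x)) (suc n) ≡ sum1 n (alt (avg x))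
cum-alt-avg x = cum-suc≡sum1 (alt (avg x)) refl

cum-δ : ∀ n → cum δ (suc n) ≡ 1ℚ
cum-δ zero = refl
cum-δ (suc n) = trans (+-identityʳ (cum δ (suc n))) (cum-δ n)

-- X stands for `tCoeff` or `uCoeff`: the alternating sign is kept outside both sequences, so `A` is
-- a plain entry 1 in either coordinate.
cum-replicate : ∀ (X : List Letter → ℕ → ℚ) → (∀ w n → X (A ∷ w) n ≡ avg (X w) n) →
  ∀ d w n → cum (X (replicate d A ++ w)) (suc n) ≡ nestedOn (ones d) (cum (X w)) (suc n)
cum-replicate X eq zero w n = refl
cum-replicate X eq (suc d) w n = begin
  cum (X (A ∷ v)) (suc n)                                              ≡⟨ cum-cong (eq v) (suc n) ⟩
  cum (avg (X v)) (suc n)                                              ≡⟨ cum-avg (X v) n ⟩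
  sum1 n (avg (X v))                                                   ≡⟨ sum1-cong (λ j → cong₂ _*_ (sym (term-⊕1 (suc j))) (cum-replicate X eq d w j)) n ⟩
  sum1 n (λ j → term (⊕ , 1) j * nestedOn (ones d) (cum (X w)) j)      ∎
  where
  open ≡-Reasoning
  v = replicate d A ++ w

sum1-alt-replicate : ∀ (X : List Letter → ℕ → ℚ) → (∀ w n → X (A ∷ w) n ≡ avg (X w) n) → ∀ d w N →
  sum1 N (alt (X (A ∷ replicate d A ++ w))) ≡ nestedOn ((⊖ , 1) ∷ ones d) (cum (X w)) (suc N)
sum1-alt-replicate X eq d w N = sum1-cong (λ j → trans (cong (sgn^ (suc j) *_) (eq (replicate d A ++ w) (suc j)))
  (trans (sym (*-assoc (sgn^ (suc j)) (inv (suc j)) (cum (X (replicate d A ++ w)) (suc j))))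
    (cong₂ _*_ (sym (term-⊖1 (suc j))) (cum-replicate X eq d w j)))) N

cum-tCoeff-wordTail : ∀ {ms} → All (1 ≤_) ms → ∀ n → cum (tCoeff (wordTail ms)) (suc n) ≡ nested (suc n) (zetaTail ms)
cum-tCoeff-wordTail [] n = cum-δ n
cum-tCoeff-wordTail (_∷_ {xs = ms} (ℕ.s≤s {n = d} _) all) n = begin
  cum (tCoeff (B ∷ A ∷ v)) (suc n)                                  ≡⟨ cum-suc≡sum1 (tCoeff (B ∷ A ∷ v)) refl n ⟩
  sum1 n (tCoeff (B ∷ A ∷ v))                                       ≡⟨ sum1-cong summand n ⟩
  sum1 n (λ j → term (⊕ , 2) j * nested j (ones d ++ zetaTail ms))  ∎
  where
  open ≡-Reasoning
  v = replicate d A ++ wordTail ms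
  summand : ∀ j → inv (suc j) * (inv (suc j) * cum (tCoeff v) (suc j)) ≡ term (⊕ , 2) (suc j) * nested (suc j) (ones d ++ zetaTail ms)
  summand j = trans (sym (*-assoc (inv (suc j)) (inv (suc j)) (cum (tCoeff v) (suc j)))) (cong₂ _*_ (sym (term-⊕2 (suc j)))
    (trans (cum-replicate tCoeff (λ w n → refl) d (wordTail ms) j)
      (trans (nestedOn-cong (ones d) (cum-tCoeff-wordTail all) j) (sym (nested-++ (ones d) (zetaTail ms) (suc j))))))

partial-zetaIdx : ∀ {d ms} → All (1 ≤_) ms → ∀ N → partial (zetaIdx (suc d ∷ ms)) N ≡ sum1 N (alt (tCoeff (word (suc d ∷ ms))))
partial-zetaIdx {d} {ms} all N = sym (trans (sum1-alt-replicate tCoeff (λ w n → refl) d (wordTail ms) N)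
  (trans (nestedOn-cong ((⊖ , 1) ∷ ones d) (cum-tCoeff-wordTail all) N) (sym (nested-++ ((⊖ , 1) ∷ ones d) (zetaTail ms) (suc N)))))

-- Summation over the signs

sum1-linear : ∀ c d x y n → c * sum1 n x + d * sum1 n y ≡ sum1 n (λ j → c * x j + d * y j)
sum1-linear c d x y zero = zeros c d
  where
  zeros : ∀ c d → c * 0ℚ + d * 0ℚ ≡ 0ℚ
  zeros = solve-∀ ℚ-ring
sum1-linear c d x y (suc n) = trans (regroup c d (sum1 n x) (sum1 n y) (x (suc n)) (y (suc n)))
  (cong (_+ (c * x (suc n) + d * y (suc n))) (sum1-linear c d x y n))
  where
  regroup : ∀ c d s t a b → c * (s + a) + d * (t + b) ≡ c * s + d * t + (c * a + d * b)
  regroup = solve-∀ ℚ-ring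

sum1-zero : ∀ x n → (∀ j → x j ≡ 0ℚ) → sum1 n x ≡ 0ℚ
sum1-zero x zero eq = refl
sum1-zero x (suc n) eq = cong₂ _+_ (sum1-zero x n eq) (eq (suc n))

module _ {S : Set} (c : S → ℚ) where

  combination : (S → ℕ → ℚ) → List S → ℕ → ℚ
  combination F L n = sumList (map (λ s → c s * F s n) L)

  sum1-combination : ∀ (a : ℕ → ℚ) (F : S → ℕ → ℚ) L m →
    sumList (map (λ s → c s * sum1 m (λ n → a n * F s n)) L) ≡ sum1 m (λ n → a n * combination F L n)
  sum1-combination a F [] m = sym (sum1-zero (λ n → a n * 0ℚ) m (λ j → *-zeroʳ (a j)))
  sum1-combination a F (s ∷ L) m = trans
    (cong (c s * sum1 m (λ n → a n * F s n) +_) (trans (sum1-combination a F L m) (sym (*-identityˡ (sum1 m (λ n → a n * combination F L n))))))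
    (trans (sum1-linear (c s) 1ℚ (λ n → a n * F s n) (λ n → a n * combination F L n) m)
      (sum1-cong (λ j → factor (c s) (a (suc j)) (F s (suc j)) (combination F L (suc j))) m))
    where
    factor : ∀ c a x y → c * (a * x) + 1ℚ * (a * y) ≡ a * (c * x + y)
    factor = solve-∀ ℚ-ring

  nestedOn-combination : ∀ es (F : S → ℕ → ℚ) L b → combination (λ s → nestedOn es (F s)) L b ≡ nestedOn es (combination F L) b
  nestedOn-combination [] F L b = refl
  nestedOn-combination (e ∷ es) F L b = trans (sum1-combination (term e) (λ s → nestedOn es (F s)) L (b ∸ 1))
    (sum1-cong (λ j → cong (term e (suc j) *_) (nestedOn-combination es F L (suc j))) (b ∸ 1))

liSum : List ℕ → ℕ → ℚ
liSum rs = combination (coeff (length rs)) (λ σs n → nested n (liTail σs rs)) (allSigns (length rs))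

sumList-signs : ∀ (f g h : List Sgn → ℚ) → (∀ σs → f (⊕ ∷ σs) ≡ - g σs) → (∀ σs → f (⊖ ∷ σs) ≡ h σs) → ∀ L →
  sumList (map f (concatMap (λ σs → (⊕ ∷ σs) ∷ (⊖ ∷ σs) ∷ []) L)) ≡ sumList (map h L) - sumList (map g L)
sumList-signs f g h eq⊕ eq⊖ [] = refl
sumList-signs f g h eq⊕ eq⊖ (σs ∷ L) = trans
  (cong₂ _+_ (eq⊕ σs) (cong₂ _+_ (eq⊖ σs) (sumList-signs f g h eq⊕ eq⊖ L)))
  (regroup (g σs) (h σs) (sumList (map g L)) (sumList (map h L)))
  where
  regroup : ∀ g h s t → - g + (h + (t - s)) ≡ h + t - (g + s)
  regroup = solve-∀ ℚ-ring

signPair : Sgn → ℕ → List Entry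
signPair σ d = (σ , 1) ∷ (σ , 1) ∷ ones d

-- The leading sign σ contributes -σ to the coefficient, and the remaining signs are summed inside
-- by linearity.
liSum-∷ : ∀ d rs n → liSum (suc d ∷ rs) n ≡ nestedOn (signPair ⊖ d) (liSum rs) n - nestedOn (signPair ⊕ d) (liSum rs) n
liSum-∷ d rs n = trans
  (sumList-signs _ (λ σs → c σs * nestedOn (signPair ⊕ d) (inner σs) n) (λ σs → c σs * nestedOn (signPair ⊖ d) (inner σs) n)
    (λ σs → trans (cong (coeff (suc k) (⊕ ∷ σs) *_) (nested-++ (signPair ⊕ d) (liTail σs rs) n)) (coeff⊕ (pow (- 1ℚ) k) (prodSgn σs) (nestedOn (signPair ⊕ d) (inner σs) n)))
    (λ σs → trans (cong (coeff (suc k) (⊖ ∷ σs) *_) (nested-++ (signPair ⊖ d) (liTail σs rs) n)) (coeff⊖ (pow (- 1ℚ) k) (prodSgn σs) (nestedOn (signPair ⊖ d) (inner σs) n)))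
    (allSigns k))
  (cong₂ _-_ (nestedOn-combination c (signPair ⊖ d) inner (allSigns k) n) (nestedOn-combination c (signPair ⊕ d) inner (allSigns k) n))
  where
  k = length rs
  c = coeff k
  inner : List Sgn → ℕ → ℚ
  inner σs n = nested n (liTail σs rs)
  coeff⊕ : ∀ p s x → - 1ℚ * p * (1ℚ * s) * x ≡ - (p * s * x)
  coeff⊕ = solve-∀ ℚ-ring
  coeff⊖ : ∀ p s x → - 1ℚ * p * (- 1ℚ * s) * x ≡ p * s * x
  coeff⊖ = solve-∀ ℚ-ring

-- The two forms in `B` produce the two values of σ. As (-1)ⁿ is split off from the coefficients,
-- du/(1-u) leads to the pair ⊖, ⊖ and du/(1+u) to the pair ⊕, ⊕ with a minus sign; the second entry
-- of each pair comes from the `A` after `B`.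
cum-uCoeff-wordTail : ∀ {rs} → All (1 ≤_) rs → ∀ n → cum (uCoeff (wordTail rs)) (suc n) ≡ liSum rs (suc n)
cum-uCoeff-wordTail [] n = cum-δ n
cum-uCoeff-wordTail (_∷_ {xs = rs} (ℕ.s≤s {n = d} _) all) n = begin
  cum (uCoeff (B ∷ A ∷ v)) (suc n)
    ≡⟨ cum-suc≡sum1 (uCoeff (B ∷ A ∷ v)) refl n ⟩
  sum1 n (uCoeff (B ∷ A ∷ v))
    ≡⟨ sum1-cong summand n ⟩
  sum1 n (λ j → 1ℚ * (term (⊖ , 1) j * nestedOn ((⊖ , 1) ∷ ones d) X j) + - 1ℚ * (term (⊕ , 1) j * nestedOn (ones (suc d)) X j))
    ≡⟨ sym (sum1-linear 1ℚ (- 1ℚ) (λ j → term (⊖ , 1) j * nestedOn ((⊖ , 1) ∷ ones d) X j) (λ j → term (⊕ , 1) j * nestedOn (ones (suc d)) X j) n) ⟩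
  1ℚ * nestedOn (signPair ⊖ d) X (suc n) + - 1ℚ * nestedOn (signPair ⊕ d) X (suc n)
    ≡⟨ units (nestedOn (signPair ⊖ d) X (suc n)) (nestedOn (signPair ⊕ d) X (suc n)) ⟩
  nestedOn (signPair ⊖ d) X (suc n) - nestedOn (signPair ⊕ d) X (suc n)
    ≡⟨ cong₂ _-_ (nestedOn-cong (signPair ⊖ d) (cum-uCoeff-wordTail all) n) (nestedOn-cong (signPair ⊕ d) (cum-uCoeff-wordTail all) n) ⟩
  nestedOn (signPair ⊖ d) (liSum rs) (suc n) - nestedOn (signPair ⊕ d) (liSum rs) (suc n)
    ≡⟨ sym (liSum-∷ d rs (suc n)) ⟩
  liSum (suc d ∷ rs) (suc n) ∎
  where
  open ≡-Reasoning
  v = replicate d A ++ wordTail rs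
  X = cum (uCoeff (wordTail rs))
  units : ∀ x y → 1ℚ * x + - 1ℚ * y ≡ x - y
  units = solve-∀ ℚ-ring
  expand : ∀ v e x y → v * (e * x - y) ≡ 1ℚ * (e * v * x) + - 1ℚ * (v * y)
  expand = solve-∀ ℚ-ring
  summand : ∀ j → uCoeff (B ∷ A ∷ v) (suc j)
    ≡ 1ℚ * (term (⊖ , 1) (suc j) * nestedOn ((⊖ , 1) ∷ ones d) X (suc j)) + - 1ℚ * (term (⊕ , 1) (suc j) * nestedOn (ones (suc d)) X (suc j))
  summand j = trans (expand (inv (suc j)) (sgn^ (suc j)) (cum (alt (uCoeff (A ∷ v))) (suc j)) (cum (uCoeff (A ∷ v)) (suc j)))
    (cong₂ (λ x y → 1ℚ * x + - 1ℚ * y)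
      (cong₂ _*_ (sym (term-⊖1 (suc j))) (trans (cum-alt-avg (uCoeff v) j) (sum1-alt-replicate uCoeff (λ w n → refl) d (wordTail rs) j)))
      (cong₂ _*_ (sym (term-⊕1 (suc j))) (cum-replicate uCoeff (λ w n → refl) (suc d) (wordTail rs) j)))

rhsPartial-word : ∀ {rs} → All (1 ≤_) rs → ∀ {k} → length rs ≡ suc k → ∀ N →
  sumList (map (λ σs → coeff k σs * partial (liIdx σs rs) N) (allSigns k)) ≡ cum (alt (uCoeff (word rs))) (suc N)
rhsPartial-word (_∷_ {xs = rs} (ℕ.s≤s {n = d} _) all) refl N = begin
  sumList (map (λ σs → c σs * nested (suc N) (((⊖ , 1) ∷ ones d) ++ liTail σs rs)) (allSigns k))
    ≡⟨ cong sumList (map-cong (λ σs → cong (c σs *_) (nested-++ ((⊖ , 1) ∷ ones d) (liTail σs rs) (suc N))) (allSigns k)) ⟩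
  combination c (λ σs → nestedOn ((⊖ , 1) ∷ ones d) (λ n → nested n (liTail σs rs))) (allSigns k) (suc N)
    ≡⟨ nestedOn-combination c ((⊖ , 1) ∷ ones d) (λ σs n → nested n (liTail σs rs)) (allSigns k) (suc N) ⟩
  nestedOn ((⊖ , 1) ∷ ones d) (liSum rs) (suc N)
    ≡⟨ nestedOn-cong ((⊖ , 1) ∷ ones d) (λ n → sym (cum-uCoeff-wordTail all n)) N ⟩
  nestedOn ((⊖ , 1) ∷ ones d) (cum (uCoeff (wordTail rs))) (suc N)
    ≡⟨ sym (sum1-alt-replicate uCoeff (λ w n → refl) d (wordTail rs) N) ⟩
  sum1 N (alt (uCoeff (word (suc d ∷ rs))))
    ≡⟨ sym (cum-alt-avg (uCoeff (replicate d A ++ wordTail rs)) N) ⟩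
  cum (alt (uCoeff (word (suc d ∷ rs)))) (suc N) ∎
  where
  open ≡-Reasoning
  k = length rs
  c = coeff k

theorem4p1 : (k : ℕ) → 1 ≤ k → (ms : List ℕ) → length ms ≡ suc k → All (1 ≤_) ms →
    Cauchy (partial (zetaIdx ms))
      × TendsToZero (λ N → partial (zetaIdx ms) N - rhsPartial k ms N)
theorem4p1 k _ ms@(suc d ∷ ms′) len all@(ℕ.s≤s _ ∷ all′) =
  IsO-dot-½^⇒cauchy {partial (zetaIdx ms)} {xCoeff w} (xCoeff-αBounded w) lhs-IsO ,
  IsO⇒tendsToZero (IsO-trans {partial (zetaIdx ms)} {λ N → dot (xCoeff w) ½^ (cutoff N)} {rhsPartial k ms} lhs-IsO rhs-IsO)
  where
  w = word ms
  adm : Admissible w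
  adm = A∷ admissible-replicate d (wordTail-admissible all′)
  lhs-IsO : IsO (λ N → partial (zetaIdx ms) N - dot (xCoeff w) ½^ (cutoff N))
  lhs-IsO = IsO-cong (λ N → cong (_- dot (xCoeff w) ½^ (cutoff N)) (sym (partial-zetaIdx {d} all′ N))) (euler-IsO adm)
  rhs≡ : ∀ N → connected [] (w ʳ++ []) N ≡ rhsPartial k ms N
  rhs≡ N = trans (connected-[]ˡ (reverse w) N) (trans (cong (λ v → cum (alt (uCoeff v)) (suc N)) (reverse-word ms))
    (sym (rhsPartial-word (All-resp-↭ (↭-sym (↭-reverse ms)) all) (trans (length-reverse ms) len) N)))
  rhs-IsO : IsO (λ N → dot (xCoeff w) ½^ (cutoff N) - rhsPartial k ms N)
  rhs-IsO = IsO-cong (λ N → cong₂ _-_ (connected-[]ʳ w N) (rhs≡ N)) (connected-reverse adm [])
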